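{- Let $\mathbf{K}$ be a pure simplicial complex of dimension $d$ satisfying the hereditary removal-collapsibility (HRC) condition. Then the second barycentric subdivision $\mathrm{sd}^2\,\mathbf{K}=\mathrm{sd}(\mathrm{sd}\,\mathbf{K})$ is star decomposable in vertices (that is, with $\mathbf{X}=\mathrm{sd}\,\mathbf{K}$, the pair $(\mathrm{sd}\,\mathbf{X},V(\mathbf{X}))$ is star decomposable in vertices).
   Context: Simplicial complexes are finite abstract simplicial complexes: finite set systems closed under taking subsets. A face with $k+1$ elements has dimension $k$; $\emptyset$ is a face of dimension $-1$ of every complex other than the void complex. The void complex $\emptyset$ (no faces, dimension $-\infty$) is distinguished from $\{\emptyset\}$ (dimension $-1$); a complex of dimension $d$ has $d\ge -1$. $V(\mathbf{K})$ is the vertex set. A facet is an inclusion-wise maximal face; a complex is pure if all its facets have the same dimension. The link of a face $\sigma\in\mathbf{K}$ is $\mathrm{lk}(\sigma,\mathbf{K})=\{\sigma'\setminus\sigma:\ \sigma'\in\mathbf{K},\ \sigma\subseteq\sigma'\}$; in particular $\mathrm{lk}(\emptyset,\mathbf{K})=\mathbf{K}$; for a vertex $v$ write $\mathrm{lk}(v,\mathbf{K})=\mathrm{lk}(\{v\},\mathbf{K})$. The barycentric subdivision is $\mathrm{sd}\,\mathbf{K}=\{\{\sigma_1,\dots,\sigma_n\}:\ n\ge 0,\ \sigma_i\in\mathbf{K},\ \emptyset\ne\sigma_1\subsetneq\cdots\subsetneq\sigma_n\}$. A vertex $v$ of $\mathbf{K}$ is identified with the vertex $\{v\}$ of $\mathrm{sd}\,\mathbf{K}$.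 Collapsibility: if a nonempty face $\sigma\in\mathbf{K}$ is properly contained in exactly one face $\tau$ of $\mathbf{K}$, then $\mathbf{K}\setminus\{\sigma,\tau\}$ arises from $\mathbf{K}$ by an elementary collapse. $\mathbf{K}$ is collapsible if some (possibly empty) sequence of elementary collapses reduces it to a point (a complex $\{\emptyset,\{v\}\}$). (RC) condition: a pure complex $\mathbf{K}$ satisfies the removal-collapsibility condition (RC) if either $\mathbf{K}$ is empty (meaning it has no vertices, i.e. $\mathbf{K}=\emptyset$ or $\mathbf{K}=\{\emptyset\}$), or there is a (possibly empty) set of facets $\phi_1,\dots,\phi_t$ of $\mathbf{K}$ such that $\mathbf{K}\setminus\{\phi_1,\dots,\phi_t\}$ (only the faces $\phi_i$ themselves are deleted) is collapsible. (HRC) condition: a pure complex $\mathbf{K}$ satisfies (HRC) if $\mathrm{lk}(\sigma,\mathbf{K})$ satisfies (RC) for every face $\sigma\in\mathbf{K}$, including $\sigma=\emptyset$. Star decomposability in vertices: let $\mathbf{X}$ be a pure $k$-dimensional complex, $k\ge -1$, and $X\subseteq V(\mathbf{X})$. Star decomposability in vertices of the pair $(\mathrm{sd}\,\mathbf{X},X)$ is defined by induction on $k$; one says that $\mathrm{sd}\,\mathbf{X}$ is star decomposable in vertices if the pair $(\mathrm{sd}\,\mathbf{X},V(\mathbf{X}))$ is. For $k=-1$, the pair $(\mathrm{sd}\{\emptyset\},\emptyset)=(\{\emptyset\},\emptyset)$ is star decomposable in vertices. For $k\ge 0$, $(\mathrm{sd}\,\mathbf{X},X)$ is star decomposable in vertices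 if there is a total order $\prec$ on $V(\mathbf{X})$ such that: (Order condition) $X=\{v\in V(\mathbf{X}): v\succeq w'\}$ for some $w'\in V(\mathbf{X})$; (Link condition) for every $w\in V(\mathbf{X})$ other than the last vertex of $\prec$, the pair $(\mathrm{sd}\,\mathrm{lk}(w,\mathbf{X}),\ \{v\in V(\mathrm{lk}(w,\mathbf{X})): v\succ w\})$ is star decomposable in vertices; (Last vertex condition) for the last vertex $\hat x$ of $\prec$, $\mathrm{sd}\,\mathrm{lk}(\hat x,\mathbf{X})$ is star decomposable in vertices. -}

module Defs where

open import Data.Bool.Properties using () renaming (_≟_ to _≟ᵇ_)
open import Data.Empty using (⊥-elim)
open import Data.Fin using (Fin; zero)
open import Data.Fin.Properties using (2↔Bool; *↔×; all?)
open import Data.Fin.Subset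
open import Data.Fin.Subset.Properties
open import Data.Integer using (ℤ; +_; 1ℤ) renaming (_-_ to _-ℤ_; _≤_ to _≤ℤ_)
open import Data.List.Base using (List; []; _∷_; _++_; map; filter)
open import Data.List.Membership.Propositional using () renaming (_∈_ to _∈ˡ_; _∉_ to _∉ˡ_)
open import Data.List.Membership.Propositional.Properties
  using (∈-map⁺; ∈-map⁻; ∈-++⁺ˡ; ∈-++⁺ʳ; ∈-filter⁺; ∈-filter⁻)
open import Data.List.Relation.Unary.All as All using (All; []; _∷_)
open import Data.List.Relation.Unary.AllPairs as AllPairs using (AllPairs; []; _∷_)
import Data.List.Relation.Unary.AllPairs.Properties as AllPairs
open import Data.List.Relation.Unary.Any using (here; there)
open import Data.List.Relation.Unary.Linked using (Linked)
import Data.List.Relation.Unary.Linked.Properties as Linked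
open import Data.Nat using (ℕ; zero; suc; _^_)
open import Data.Product using (∃; _×_; _,_; proj₁; proj₂)
open import Data.Product.Function.NonDependent.Propositional using (_×-↔_)
open import Data.Sum using (_⊎_; inj₁; inj₂)
open import Data.Vec using ([]; _∷_; here; there)
open import Data.Vec.Properties using () renaming (≡-dec to Vec-≡-dec)
open import Function using (_on_; _⇔_; mk⇔; _↔_; mk↔ₛ′; Equivalence; Inverse)
open import Function.Construct.Composition using (_↔-∘_)
open import Function.Construct.Symmetry using (↔-sym)
open import Level using (0ℓ)
open import Relation.Binary using (Rel; IsStrictTotalOrder; DecidableEquality)
open import Relation.Binary.PropositionalEquality using (_≡_; refl; sym; subst)
open import Relation.Nullary using (¬_; yes; no; _×-dec_; _⊎-dec_; _→-dec_; contradiction)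
import Relation.Nullary.Decidable as Dec
open import Relation.Unary using (Pred; Decidable)

private
  variable
    n : ℕ

_≟ˢ_ : DecidableEquality (Subset n)
_≟ˢ_ = Vec-≡-dec _≟ᵇ_

------------------------------------------------------------------------
-- Simplicial complexes

-- `Fin n` is only an ambient set of labels: a label v is a vertex of K
-- when ⁅ v ⁆ is a face.  The void complex (no faces) is allowed.

record Complex (n : ℕ) : Set₁ where
  field
    Face   : Pred (Subset n) 0ℓ
    face?  : Decidable Face
    closed : ∀ {σ τ} → σ ⊆ τ → Face τ → Face σ

open Complex public

IsVertex : Complex n → Pred (Fin n) 0ℓ
IsVertex K v = Face K ⁅ v ⁆

dim : Subset n → ℤ
dim σ = + ∣ σ ∣ -ℤ 1ℤ

-- Never satisfied by the void complex, whose dimension is -∞.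
HasDimension : Complex n → ℤ → Set
HasDimension K d = (∃ λ σ → Face K σ × dim σ ≡ d) × (∀ σ → Face K σ → dim σ ≤ℤ d)

Facet : Complex n → Pred (Subset n) 0ℓ
Facet K φ = Face K φ × (∀ ψ → Face K ψ → φ ⊆ ψ → ψ ≡ φ)

Pure : Complex n → Set
Pure K = ∀ φ ψ → Facet K φ → Facet K ψ → dim φ ≡ dim ψ

------------------------------------------------------------------------
-- Links

lk : Subset n → Complex n → Complex n
lk {n} σ K = record { Face = LkFace ; face? = lkFace? ; closed = lkClosed }
  where
  LkFace : Pred (Subset n) 0ℓ
  LkFace τ = ∃ λ σ′ → Face K σ′ × σ ⊆ σ′ × τ ≡ σ′ ─ σ

  lkFace? : Decidable LkFace
  lkFace? τ = anySubset? λ σ′ → face? K σ′ ×-dec ((σ ⊆? σ′) ×-dec (τ ≟ˢ (σ′ ─ σ)))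

  x∈p─q⇒x∉q : ∀ {m} {x : Fin m} (p q : Subset m) → x ∈ p ─ q → x ∉ q
  x∈p─q⇒x∉q (_ ∷ p) (_ ∷ q) (there x∈p─q) (there x∈q) = x∈p─q⇒x∉q p q x∈p─q x∈q

  lkClosed : ∀ {τ′ τ} → τ′ ⊆ τ → LkFace τ → LkFace τ′
  lkClosed {τ′} τ′⊆τ (σ′ , Kσ′ , σ⊆σ′ , refl) =
    τ′ ∪ σ , closed K τ′∪σ⊆σ′ Kσ′ , q⊆p∪q τ′ σ , ⊆-antisym to from
    where
    τ′∪σ⊆σ′ : τ′ ∪ σ ⊆ σ′
    τ′∪σ⊆σ′ x∈ with x∈p∪q⁻ τ′ σ x∈
    ... | inj₁ x∈τ′ = p─q⊆p σ′ σ (τ′⊆τ x∈τ′)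
    ... | inj₂ x∈σ  = σ⊆σ′ x∈σ

    to : τ′ ⊆ (τ′ ∪ σ) ─ σ
    to x∈τ′ = x∈p∧x∉q⇒x∈p─q (p⊆p∪q σ x∈τ′) (x∈p─q⇒x∉q σ′ σ (τ′⊆τ x∈τ′))

    from : (τ′ ∪ σ) ─ σ ⊆ τ′
    from x∈ with x∈p∪q⁻ τ′ σ (p─q⊆p (τ′ ∪ σ) σ x∈)
    ... | inj₁ x∈τ′ = x∈τ′
    ... | inj₂ x∈σ  = contradiction x∈σ (x∈p─q⇒x∉q (τ′ ∪ σ) σ x∈)

------------------------------------------------------------------------
-- Barycentric subdivision

-- The labels of sd K are the subsets of Fin n, numbered by Fin (2 ^ n).

Subset↔Fin : ∀ n → Subset n ↔ Fin (2 ^ n)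
Subset↔Fin zero    = mk↔ₛ′ (λ _ → zero) (λ _ → []) (λ { zero → refl }) (λ { [] → refl })
Subset↔Fin (suc n) = ↔-sym *↔× ↔-∘ ((↔-sym 2↔Bool ×-↔ Subset↔Fin n) ↔-∘ uncons↔)
  where
  uncons↔ : Subset (suc n) ↔ (Side × Subset n)
  uncons↔ = mk↔ₛ′ (λ { (s ∷ p) → s , p }) (λ { (s , p) → s ∷ p }) (λ _ → refl) (λ { (_ ∷ _) → refl })

encode : Subset n → Fin (2 ^ n)
encode {n} = Inverse.to (Subset↔Fin n)

decode : Fin (2 ^ n) → Subset n
decode {n} = Inverse.from (Subset↔Fin n)

encode-decode : (i : Fin (2 ^ n)) → encode {n} (decode i) ≡ i
encode-decode {n} = Inverse.strictlyInverseˡ (Subset↔Fin n)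

decode-encode : (σ : Subset n) → decode (encode σ) ≡ σ
decode-encode {n} = Inverse.strictlyInverseʳ (Subset↔Fin n)

-- S = { σ₁ , … , σₘ } with σᵢ ∈ K and ∅ ≠ σ₁ ⊊ ⋯ ⊊ σₘ.
SdFace : Complex n → Pred (Subset (2 ^ n)) 0ℓ
SdFace {n} K S = ∃ λ (σs : List (Subset n)) →
  All (λ σ → Nonempty σ × Face K σ) σs ×
  Linked _⊂_ σs ×
  (∀ i → i ∈ S ⇔ decode i ∈ˡ σs)

-- Equivalent description of the faces, used to decide SdFace.
SdChain : Complex n → Pred (Subset (2 ^ n)) 0ℓ
SdChain {n} K S =
  (∀ i → i ∈ S → Nonempty (decode {n} i) × Face K (decode i)) ×
  (∀ i → i ∈ S → ∀ j → j ∈ S → decode {n} i ⊆ decode j ⊎ decode {n} j ⊆ decode i)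

sdChain? : (K : Complex n) → Decidable (SdChain K)
sdChain? K S =
  all? (λ i → (i ∈? S) →-dec (nonempty? (decode i) ×-dec face? K (decode i)))
  ×-dec
  all? (λ i → (i ∈? S) →-dec all? (λ j → (j ∈? S) →-dec
    ((decode i ⊆? decode j) ⊎-dec (decode j ⊆? decode i))))

private
  comparable : ∀ {σs : List (Subset n)} {σ τ} → AllPairs _⊂_ σs →
               σ ∈ˡ σs → τ ∈ˡ σs → σ ⊆ τ ⊎ τ ⊆ σ
  comparable _          (here refl) (here refl) = inj₁ ⊆-refl
  comparable (σ⊂ ∷ _)   (here refl) (there τ∈)  = inj₁ (proj₁ (All.lookup σ⊂ τ∈))
  comparable (τ⊂ ∷ _)   (there σ∈)  (here refl) = inj₂ (proj₁ (All.lookup τ⊂ σ∈))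
  comparable (_ ∷ pairs) (there σ∈) (there τ∈)  = comparable pairs σ∈ τ∈

  -- All subsets, listed along a linear extension of inclusion.
  subsets : ∀ n → List (Subset n)
  subsets zero    = [] ∷ []
  subsets (suc n) = map (outside ∷_) (subsets n) ++ map (inside ∷_) (subsets n)

  ∈-subsets : (σ : Subset n) → σ ∈ˡ subsets n
  ∈-subsets []            = here refl
  ∈-subsets (outside ∷ σ) = ∈-++⁺ˡ (∈-map⁺ (outside ∷_) (∈-subsets σ))
  ∈-subsets (inside  ∷ σ) = ∈-++⁺ʳ _ (∈-map⁺ (inside ∷_) (∈-subsets σ))

  ∷-⊈ : ∀ s {σ τ : Subset n} → τ ⊈ σ → s ∷ τ ⊈ s ∷ σ
  ∷-⊈ s τ⊈σ sτ⊆sσ = τ⊈σ (drop-∷-⊆ sτ⊆sσ)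

  subsets-ordered : ∀ n → AllPairs (λ σ τ → τ ⊈ σ) (subsets n)
  subsets-ordered zero    = [] ∷ []
  subsets-ordered (suc n) = AllPairs.++⁺ (half outside) (half inside)
    (All.tabulate λ σ∈ → All.tabulate λ τ∈ → cross (∈-map⁻ _ σ∈) (∈-map⁻ _ τ∈))
    where
    half : ∀ s → AllPairs (λ σ τ → τ ⊈ σ) (map (s ∷_) (subsets n))
    half s = AllPairs.map⁺ (AllPairs.map (∷-⊈ s) (subsets-ordered n))

    cross : ∀ {σ τ} → (∃ λ σ′ → σ′ ∈ˡ subsets n × σ ≡ outside ∷ σ′) →
            (∃ λ τ′ → τ′ ∈ˡ subsets n × τ ≡ inside ∷ τ′) → τ ⊈ σ
    cross (_ , _ , refl) (_ , _ , refl) τ⊆σ with τ⊆σ here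
    ... | ()

  ⊆∧⊉⇒⊂ : {σ τ : Subset n} → σ ⊆ τ → τ ⊈ σ → σ ⊂ τ
  ⊆∧⊉⇒⊂ {σ = σ} {τ} σ⊆τ τ⊈σ with σ ⊂? τ
  ... | yes σ⊂τ = σ⊂τ
  ... | no  σ⊄τ = ⊥-elim (τ⊈σ τ⊆σ)
    where
    τ⊆σ : τ ⊆ σ
    τ⊆σ {x} x∈τ with x ∈? σ
    ... | yes x∈σ = x∈σ
    ... | no  x∉σ = ⊥-elim (σ⊄τ (σ⊆τ , x , x∈τ , x∉σ))

  order : {σs : List (Subset n)} → (∀ {σ τ} → σ ∈ˡ σs → τ ∈ˡ σs → σ ⊆ τ ⊎ τ ⊆ σ) →
          AllPairs (λ σ τ → τ ⊈ σ) σs → AllPairs _⊂_ σs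
  order cmp []           = []
  order {σs = σ ∷ _} cmp (σ≱ ∷ pairs) =
    All.tabulate (λ τ∈ → step (cmp (here refl) (there τ∈)) (All.lookup σ≱ τ∈)) ∷
    order (λ σ∈ τ∈ → cmp (there σ∈) (there τ∈)) pairs
    where
    step : ∀ {τ} → σ ⊆ τ ⊎ τ ⊆ σ → τ ⊈ σ → σ ⊂ τ
    step (inj₁ σ⊆τ) τ⊈σ = ⊆∧⊉⇒⊂ σ⊆τ τ⊈σ
    step (inj₂ τ⊆σ) τ⊈σ = ⊥-elim (τ⊈σ τ⊆σ)

sdFace⇔sdChain : (K : Complex n) (S : Subset (2 ^ n)) → SdFace K S ⇔ SdChain K S
sdFace⇔sdChain {n} K S = mk⇔ to from
  where
  to : SdFace K S → SdChain K S
  to (σs , faces , linked , S≗σs) =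
    (λ i i∈S → All.lookup faces (Equivalence.to (S≗σs i) i∈S)) ,
    (λ i i∈S j j∈S → comparable (Linked.Linked⇒AllPairs ⊂-trans linked)
                       (Equivalence.to (S≗σs i) i∈S) (Equivalence.to (S≗σs j) j∈S))

  from : SdChain K S → SdFace K S
  from (faces , cmp) = σs ,
    All.tabulate (λ {σ} σ∈ → subst (λ ρ → Nonempty ρ × Face K ρ) (decode-encode σ) (faces _ (∈S σ∈))) ,
    Linked.AllPairs⇒Linked (order cmp′ (AllPairs.filter⁺ P? (subsets-ordered n))) ,
    λ i → mk⇔
      (λ i∈S → ∈-filter⁺ P? (∈-subsets (decode i)) (subst (_∈ S) (sym (encode-decode {n} i)) i∈S))
      (λ i∈ → subst (_∈ S) (encode-decode {n} i) (∈S i∈))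
    where
    P? : Decidable (λ (σ : Subset n) → encode σ ∈ S)
    P? σ = encode σ ∈? S

    σs : List (Subset n)
    σs = filter P? (subsets n)

    ∈S : ∀ {σ} → σ ∈ˡ σs → encode σ ∈ S
    ∈S σ∈ = proj₂ (∈-filter⁻ P? {xs = subsets n} σ∈)

    cmp′ : ∀ {σ τ} → σ ∈ˡ σs → τ ∈ˡ σs → σ ⊆ τ ⊎ τ ⊆ σ
    cmp′ {σ} {τ} σ∈ τ∈ with cmp _ (∈S σ∈) _ (∈S τ∈)
    ... | c rewrite decode-encode σ | decode-encode τ = c

sd : Complex n → Complex (2 ^ n)
sd K = record
  { Face   = SdFace K
  ; face?  = λ S → Dec.map′ (Equivalence.from (sdFace⇔sdChain K S))
                            (Equivalence.to (sdFace⇔sdChain K S)) (sdChain? K S)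
  ; closed = λ {S} {T} S⊆T KT → Equivalence.from (sdFace⇔sdChain K S)
      (let faces , cmp = Equivalence.to (sdFace⇔sdChain K T) KT in
       (λ i i∈S → faces i (S⊆T i∈S)) , (λ i i∈S j j∈S → cmp i (S⊆T i∈S) j (S⊆T j∈S)))
  }

------------------------------------------------------------------------
-- Collapsibility

-- Formulated for set systems, so that deleting faces is set difference.

_∖_ : Pred (Subset n) 0ℓ → List (Subset n) → Pred (Subset n) 0ℓ
(F ∖ σs) ρ = F ρ × ρ ∉ˡ σs

record Free (F : Pred (Subset n) 0ℓ) (σ τ : Subset n) : Set where
  field
    σ∈F      : F σ
    nonempty : Nonempty σ
    τ∈F      : F τ
    σ⊂τ      : σ ⊂ τ
    unique   : ∀ ρ → F ρ → σ ⊂ ρ → ρ ≡ τ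

data Collapsible (F : Pred (Subset n) 0ℓ) : Set where
  point    : ∀ v → (∀ σ → F σ ⇔ (σ ≡ ⊥ ⊎ σ ≡ ⁅ v ⁆)) → Collapsible F
  collapse : ∀ σ τ → Free F σ τ → Collapsible (F ∖ (σ ∷ τ ∷ [])) → Collapsible F

------------------------------------------------------------------------
-- (RC) and (HRC)

RC : Complex n → Set
RC K = (∀ v → ¬ IsVertex K v) ⊎
       (∃ λ φs → All (Facet K) φs × Collapsible (Face K ∖ φs))

HRC : Complex n → Set
HRC K = ∀ σ → Face K σ → RC (lk σ K)

------------------------------------------------------------------------
-- Star decomposability in vertices

IsLast : Complex n → Rel (Fin n) 0ℓ → Pred (Fin n) 0ℓ
IsLast X _≺_ x̂ = IsVertex X x̂ × (∀ v → IsVertex X v → v ≡ x̂ ⊎ v ≺ x̂)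

-- `SdStarDecomposable X W` says that the pair (sd X , W) is star
-- decomposable in vertices, where W ⊆ V(X).  The relation _≺_ is required
-- to be an order on V(X) only; it is arbitrary on the other labels.

data SdStarDecomposable {n} (X : Complex n) (W : Pred (Fin n) 0ℓ) : Set₁ where
  dim-1 :
    (∀ σ → Face X σ ⇔ σ ≡ ⊥) →
    (∀ v → ¬ W v) →
    SdStarDecomposable X W
  dim≥0 :
    (k : ℕ) → Pure X → HasDimension X (+ k) →
    (_≺_ : Rel (Fin n) 0ℓ) →
    IsStrictTotalOrder {A = ∃ (IsVertex X)} (_≡_ on proj₁) (_≺_ on proj₁) →
    (orderCondition :
      ∃ λ w′ → IsVertex X w′ × (∀ v → W v ⇔ (IsVertex X v × (v ≡ w′ ⊎ w′ ≺ v)))) →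
    (linkCondition :
      ∀ w → IsVertex X w → ¬ IsLast X _≺_ w →
      SdStarDecomposable (lk ⁅ w ⁆ X) (λ v → IsVertex (lk ⁅ w ⁆ X) v × w ≺ v)) →
    (lastVertexCondition :
      ∀ x̂ → IsLast X _≺_ x̂ →
      SdStarDecomposable (lk ⁅ x̂ ⁆ X) (IsVertex (lk ⁅ x̂ ⁆ X))) →
    SdStarDecomposable X W

-- X can be recovered from sd X, as its vertices are the nonempty faces of X.
data StarDecomposableInVertices : ∀ {m} → Complex m → Set₁ where
  subdivision : (X : Complex n) → SdStarDecomposable X (IsVertex X) →
                StarDecomposableInVertices (sd X)

-- The complexes arising from sd K by taking links of vertices are the clique complexes of
-- sets P of faces of K under comparability, so star decompositions can be described by
-- listing P.  The link of σ in sd K is the join of the subdivided boundary of σ with the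
-- subdivided link of σ in K.  List first the removed facets, then the pairs σ , τ of the
-- collapse in order, then the final vertex: the later neighbours of σ are its proper faces and
-- τ, those of τ are its proper faces other than σ.  Both are targets in the join by induction
-- on the dimension, provided that one uses a stronger notion for targets such as the boundary
-- of τ without σ (a ball), which stays valid as a target after joining with any complex.
module Submission where

open import Defs
open import Data.Empty using (⊥-elim)
open import Data.Fin using (Fin)
import Data.Fin.Properties as Fin
open import Data.Fin.Subset
open import Data.Fin.Subset.Properties
open import Data.Integer using (ℤ; +_; 1ℤ; -1ℤ; +≤+) renaming (_-_ to _-ℤ_; _≤_ to _≤ℤ_)
import Data.Integer.Properties as ℤ
open import Algebra.Properties.AbelianGroup ℤ.+-0-abelianGroup using (∙-cancelʳ)
open import Data.List.Base using (List; []; _∷_; _++_; [_]; map)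
open import Data.List.Membership.Propositional using () renaming (_∈_ to _∈ˡ_; _∉_ to _∉ˡ_)
open import Data.List.Membership.Propositional.Properties
  using (∈-++⁺ˡ; ∈-++⁺ʳ; ∈-++⁻; ∈-map⁺; ∈-map⁻)
import Data.List.Membership.DecPropositional as DecMembership
open import Data.List.Properties using (++-assoc)
open import Data.List.Relation.Unary.All as All using (All; []; _∷_)
open import Data.List.Relation.Unary.AllPairs as AllPairs using (AllPairs; []; _∷_)
import Data.List.Relation.Unary.AllPairs.Properties as AllPairs
open import Data.List.Relation.Unary.Any using (here; there)
open import Data.Nat using (ℕ; zero; suc; _+_; _≤_; _<_; s≤s)
open import Data.Nat.Induction using (<-rec)
import Data.Nat.Properties as ℕ
open import Data.Nat.Solver using (module +-*-Solver)
open import Data.Product using (∃; _×_; _,_; proj₁; proj₂)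
open import Data.Sum using (_⊎_; inj₁; inj₂; [_,_]′)
import Data.Sum as Sum
open import Data.Vec using ([]; _∷_; here; there)
open import Function using (id; _∘_; _on_; _⇔_; mk⇔; Equivalence)
open import Level using (0ℓ)
open import Relation.Binary
  using (Rel; Symmetric; DecidableEquality; IsStrictTotalOrder; Tri; tri<; tri≈; tri>)
open import Relation.Binary.PropositionalEquality
  using (_≡_; _≢_; refl; sym; trans; cong; subst; subst₂)
open import Relation.Nullary using (¬_; yes; no; _×-dec_; contradiction)
open import Relation.Unary.Algebra using (∪-cong)
open import Relation.Unary.Properties using (≐-refl; ≐-sym; ≐-trans)
open import Relation.Unary using (Pred; _≐_) renaming (_∪_ to _∪ᵖ_; _⊆_ to _⊆ᵖ_; ∅ to ∅ᵖ)

open +-*-Solver using (solve; _:+_; _:=_; con)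
open Equivalence using (to; from)

-- The obstacle is the order condition, which forbids an empty target over a nonempty link. Suppose
-- that a target `B` inside `Y` is kept unchanged in the join of `X` and `Y`. When `B` is two
-- isolated points, the link of the first one in the join contains all of `X`, but no later
-- neighbour lies in `B`. Strong decompositions exclude this at every level of iterated links in the
-- target, which is why `empty` is only weak. The last vertex of any decomposition is a strong
-- target. A second demand comes from free faces: in the link of `σ` the target above `σ` is the
-- single vertex `τ`, so the collapse of the link of `σ` in `K` must end at a prescribed vertex,
-- whereas (RC) supplies some end of its own choice. Collapses therefore have to be redirected. The
-- subdivided boundary of `σ` needs no separate theory: the boundary of a simplex satisfies the same
-- hereditary hypothesis, so one induction over all complexes serves both factors of the join.

private
  variable
    n : ℕ

-- Subsets, facets and links

x∈p─q⇒x∉q : ∀ {x} (p q : Subset n) → x ∈ p ─ q → x ∉ q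
x∈p─q⇒x∉q (_ ∷ p) (_ ∷ q) (there x∈p─q) (there x∈q) = x∈p─q⇒x∉q p q x∈p─q x∈q

x∈p-y⇒x≢y : ∀ {x} (p : Subset n) y → x ∈ p - y → x ≢ y
x∈p-y⇒x≢y p y x∈ refl = x∈p─q⇒x∉q p ⁅ y ⁆ x∈ (x∈⁅x⁆ y)

x∉p⇒∣p∪⁅x⁆∣≡1+∣p∣ : ∀ {x} {p : Subset n} → x ∉ p → ∣ p ∪ ⁅ x ⁆ ∣ ≡ suc ∣ p ∣
x∉p⇒∣p∪⁅x⁆∣≡1+∣p∣ {x = Fin.zero}  {inside  ∷ p} x∉p = contradiction here x∉p
x∉p⇒∣p∪⁅x⁆∣≡1+∣p∣ {x = Fin.zero}  {outside ∷ p} x∉p = cong (suc ∘ ∣_∣) (∪-identityʳ p)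
x∉p⇒∣p∪⁅x⁆∣≡1+∣p∣ {x = Fin.suc _} {inside  ∷ p} x∉p = cong suc (x∉p⇒∣p∪⁅x⁆∣≡1+∣p∣ (x∉p ∘ there))
x∉p⇒∣p∪⁅x⁆∣≡1+∣p∣ {x = Fin.suc _} {outside ∷ p} x∉p = x∉p⇒∣p∪⁅x⁆∣≡1+∣p∣ (x∉p ∘ there)

p-x∪⁅x⁆≡p : ∀ {x} {p : Subset n} → x ∈ p → (p - x) ∪ ⁅ x ⁆ ≡ p
p-x∪⁅x⁆≡p {x = x} {p} x∈p = ⊆-antisym
  (λ y∈ → [ p─q⊆p p ⁅ x ⁆ , (λ y∈⁅x⁆ → subst (_∈ p) (sym (x∈⁅y⁆⇒x≡y x y∈⁅x⁆)) x∈p) ]′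
            (x∈p∪q⁻ (p - x) ⁅ x ⁆ y∈))
  back
  where
  back : p ⊆ (p - x) ∪ ⁅ x ⁆
  back {y} y∈p with y Fin.≟ x
  ... | yes refl = x∈p∪q⁺ (inj₂ (x∈⁅x⁆ x))
  ... | no  y≢x  = x∈p∪q⁺ (inj₁ (x∈p∧x≢y⇒x∈p-y y∈p y≢x))

x∈p⇒1+∣p-x∣≡∣p∣ : ∀ {x} {p : Subset n} → x ∈ p → suc ∣ p - x ∣ ≡ ∣ p ∣
x∈p⇒1+∣p-x∣≡∣p∣ {x = x} {p} x∈p =
  trans (sym (x∉p⇒∣p∪⁅x⁆∣≡1+∣p∣ (λ x∈ → x∈p-y⇒x≢y p x x∈ refl))) (cong ∣_∣ (p-x∪⁅x⁆≡p x∈p))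

p⊆q∧q⊈p⇒p⊂q : {p q : Subset n} → p ⊆ q → ¬ q ⊆ p → p ⊂ q
p⊆q∧q⊈p⇒p⊂q {p = p} {q} p⊆q q⊈p with p ⊂? q
... | yes p⊂q = p⊂q
... | no  p⊄q = ⊥-elim (q⊈p q⊆p)
  where
  q⊆p : q ⊆ p
  q⊆p {x} x∈q with x ∈? p
  ... | yes x∈p = x∈p
  ... | no  x∉p = ⊥-elim (p⊄q (p⊆q , x , x∈q , x∉p))

p⊆q⇒p≡q⊎p⊂q : {p q : Subset n} → p ⊆ q → p ≡ q ⊎ p ⊂ q
p⊆q⇒p≡q⊎p⊂q {p = p} {q} p⊆q with q ⊆? p
... | yes q⊆p = inj₁ (⊆-antisym p⊆q q⊆p)
... | no  q⊈p = inj₂ (p⊆q∧q⊈p⇒p⊂q p⊆q q⊈p)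

facetAbove : (X : Complex n) {σ : Subset n} → Face X σ → ∃ λ φ → Facet X φ × σ ⊆ φ
facetAbove {n} X {σ} Xσ = go n σ Xσ (ℕ.m≤n+m n ∣ σ ∣)
  where
  go : ∀ fuel σ → Face X σ → n ≤ ∣ σ ∣ + fuel → ∃ λ φ → Facet X φ × σ ⊆ φ
  go fuel σ Xσ n≤ with anySubset? (λ ψ → face? X ψ ×-dec (σ ⊂? ψ))
  ... | no ∄ψ = σ , (Xσ , λ ψ Xψ σ⊆ψ →
          [ sym , (λ σ⊂ψ → contradiction (ψ , Xψ , σ⊂ψ) ∄ψ) ]′ (p⊆q⇒p≡q⊎p⊂q σ⊆ψ)) , id
  go zero σ Xσ n≤ | yes (ψ , Xψ , σ⊂ψ) = contradiction
    (ℕ.<-≤-trans (p⊂q⇒∣p∣<∣q∣ σ⊂ψ) (ℕ.≤-trans (∣p∣≤n ψ) (subst (n ≤_) (ℕ.+-identityʳ _) n≤)))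
    (ℕ.<-irrefl refl)
  go (suc fuel) σ Xσ n≤ | yes (ψ , Xψ , σ⊂ψ)
    with go fuel ψ Xψ (ℕ.≤-trans n≤ (subst (_≤ ∣ ψ ∣ + fuel) (sym (ℕ.+-suc ∣ σ ∣ fuel))
                                      (ℕ.+-monoˡ-≤ fuel (p⊂q⇒∣p∣<∣q∣ σ⊂ψ))))
  ... | φ , facet , ψ⊆φ = φ , facet , ψ⊆φ ∘ proj₁ σ⊂ψ

lk-facet : (X : Complex n) {φ : Subset n} {i : Fin n} → Facet X φ → i ∈ φ →
           Facet (lk ⁅ i ⁆ X) (φ - i)
lk-facet X {φ} {i} (Xφ , max) i∈φ = (φ , Xφ , ⁅i⁆⊆ i∈φ , refl) ,
  λ { _ (σ , Xσ , i∈σ , refl) φ-i⊆ → cong (_- i) (max σ Xσ (λ {x} → below σ i∈σ φ-i⊆)) }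
  where
  ⁅i⁆⊆ : ∀ {σ} → i ∈ σ → ⁅ i ⁆ ⊆ σ
  ⁅i⁆⊆ {σ} i∈σ x∈ = subst (_∈ σ) (sym (x∈⁅y⁆⇒x≡y i x∈)) i∈σ
  below : ∀ σ → ⁅ i ⁆ ⊆ σ → φ - i ⊆ σ - i → φ ⊆ σ
  below σ i∈σ sub {x} x∈φ with x Fin.≟ i
  ... | yes refl = i∈σ (x∈⁅x⁆ i)
  ... | no  x≢i  = p─q⊆p σ ⁅ i ⁆ (sub (x∈p∧x≢y⇒x∈p-y x∈φ x≢i))

-- Star decompositions as lists of vertices

data Mode : Set where
  weak strong : Mode

module Decomposition {V : Set} (_∼_ : Rel V 0ℓ) (∼-sym : Symmetric _∼_) where

  private
    variable
      m m₁ m₂ : Mode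
      k l : ℕ
      x z : V
      xs ys : List V
      A B P P′ Q R T T′ W W′ X Y : Pred V 0ℓ

  Nbr : Pred V 0ℓ → V → Pred V 0ℓ
  Nbr P w v = P v × w ∼ v

  Final : List V → V → Pred V 0ℓ
  Final xs z = (_∈ˡ xs) ∪ᵖ (_≡ z)

  -- Decomp weak k P W encodes star decomposability of (X , W) for X the clique complex of P, of
  -- dimension k - 1; the order is xs ++ ys ++ [ z ].  In a strong decomposition the links of the
  -- vertices of W before z are again strong, so in dimension 0 the target W is a single vertex.
  data Decomp : Mode → ℕ → Pred V 0ℓ → Pred V 0ℓ → Set₁
  data Sheds (P : Pred V 0ℓ) (m : Mode) (k : ℕ) (T : Pred V 0ℓ) : List V → Set₁

  data Decomp where
    empty : (∀ {v} → ¬ P v) → (∀ {v} → ¬ W v) → Decomp weak 0 P W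
    order : ∀ xs ys z → P ≐ (_∈ˡ xs) ∪ᵖ Final ys z → W ≐ Final ys z →
            Sheds P weak k (Final ys z) xs → Sheds P m k (_≡ z) ys →
            Decomp weak k (Nbr P z) (Nbr P z) → Decomp m (suc k) P W

  -- `T` collects what follows the whole list in the order, so the target in each link consists of
  -- the later neighbours.
  data Sheds P m k T where
    []  : Sheds P m k T []
    _∷_ : Decomp m k (Nbr P x) (Nbr ((_∈ˡ xs) ∪ᵖ T) x) → Sheds P m k T xs →
          Sheds P m k T (x ∷ xs)

  Nbr-cong : P ≐ Q → Nbr P x ≐ Nbr Q x
  Nbr-cong (f , g) = (λ (p , e) → f p , e) , (λ (p , e) → g p , e)

  Decomp-resp : P ≐ P′ → W ≐ W′ → Decomp m k P W → Decomp m k P′ W′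
  Sheds-resp  : P ≐ P′ → T ≐ T′ → Sheds P m k T xs → Sheds P′ m k T′ xs

  Decomp-resp (_ , g) (_ , g′) (empty ¬P ¬W) = empty (¬P ∘ g) (¬W ∘ g′)
  Decomp-resp p w (order xs ys z pe we ss ts d) =
    order xs ys z (≐-trans (≐-sym p) pe) (≐-trans (≐-sym w) we)
      (Sheds-resp p ≐-refl ss) (Sheds-resp p ≐-refl ts)
      (Decomp-resp (Nbr-cong p) (Nbr-cong p) d)

  Sheds-resp p t []       = []
  Sheds-resp p t (d ∷ ss) =
    Decomp-resp (Nbr-cong p) (Nbr-cong (∪-cong ≐-refl t)) d ∷ Sheds-resp p t ss

  weaken       : Decomp m k P W → Decomp weak k P W
  weaken-Sheds : Sheds P m k T xs → Sheds P weak k T xs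

  weaken (empty ¬P ¬W) = empty ¬P ¬W
  weaken (order xs ys z pe we ss ts d) = order xs ys z pe we ss (weaken-Sheds ts) d

  weaken-Sheds []       = []
  weaken-Sheds (d ∷ ss) = weaken d ∷ weaken-Sheds ss

  ++-∪ : ∀ xs {ys} → (_∈ˡ (xs ++ ys)) ∪ᵖ T ≐ (_∈ˡ xs) ∪ᵖ ((_∈ˡ ys) ∪ᵖ T)
  ++-∪ xs =
    [ Sum.map id inj₁ ∘ ∈-++⁻ xs , inj₂ ∘ inj₂ ]′ ,
    [ inj₁ ∘ ∈-++⁺ˡ , [ inj₁ ∘ ∈-++⁺ʳ xs , inj₂ ]′ ]′

  ∪-emptyˡ : (∀ {v} → ¬ P v) → P ∪ᵖ Q ≐ Q
  ∪-emptyˡ ¬P = [ ⊥-elim ∘ ¬P , id ]′ , inj₂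

  ∪-emptyʳ : (∀ {v} → ¬ Q v) → P ∪ᵖ Q ≐ P
  ∪-emptyʳ ¬Q = [ id , ⊥-elim ∘ ¬Q ]′ , inj₁

  []-∪ : (_∈ˡ []) ∪ᵖ T ≐ T
  []-∪ = ∪-emptyˡ λ ()

  Sheds-++ : Sheds P m k ((_∈ˡ ys) ∪ᵖ T) xs → Sheds P m k T ys → Sheds P m k T (xs ++ ys)
  Sheds-++ []       ts = ts
  Sheds-++ {xs = _ ∷ xs} (d ∷ ss) ts =
    Decomp-resp ≐-refl (Nbr-cong (≐-sym (++-∪ xs))) d ∷ Sheds-++ ss ts

  -- The order alone, without the cut that marks the target: later neighbours do not depend on where
  -- the cut is made, only the modes of the links do.
  record Linear (k : ℕ) (P : Pred V 0ℓ) : Set₁ where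
    constructor linear
    field
      init  : List V
      last  : V
      exact : P ≐ Final init last
      sheds : Sheds P weak k (_≡ last) init
      link  : Decomp weak k (Nbr P last) (Nbr P last)

  toLinear : Decomp m (suc k) P W → Linear k P
  toLinear (order xs ys z pe we ss ts d) = linear (xs ++ ys) z
    (≐-trans pe (≐-sym (++-∪ xs)))
    (Sheds-++ ss (weaken-Sheds ts)) d

  Decomp-all : Decomp m k P W → Decomp weak k P P
  Decomp-all (empty ¬P ¬W) = empty ¬P ¬P
  Decomp-all d@(order _ _ _ _ _ _ _ _) with toLinear d
  ... | linear xs z e ss d′ = order [] xs z (≐-trans e (≐-sym []-∪)) e [] ss d′

  -- With no other vertex in the target, there is no link on which strength could impose anything.
  Linear-last : (L : Linear k P) → Decomp strong (suc k) P (_≡ Linear.last L)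
  Linear-last (linear xs z e ss d) =
    order xs [] z (≐-trans e (∪-cong ≐-refl (≐-sym []-∪))) (≐-sym []-∪)
      (Sheds-resp ≐-refl (≐-sym []-∪) ss) [] d

  -- Joins

  Joined : Pred V 0ℓ → Pred V 0ℓ → Set
  Joined X Y = ∀ {x y} → X x → Y y → x ∼ y

  Joined-sym : Joined X Y → Joined Y X
  Joined-sym j y x = ∼-sym (j x y)

  Nbr-∪ˡ : Joined X Y → X x → Nbr (X ∪ᵖ Y) x ≐ Nbr X x ∪ᵖ Y
  Nbr-∪ˡ j x∈X =
    (λ { (inj₁ p , e) → inj₁ (p , e) ; (inj₂ q , e) → inj₂ q }) ,
    (λ { (inj₁ (p , e)) → inj₁ p , e ; (inj₂ q) → inj₂ q , j x∈X q })

  Nbr-∪ʳ : Joined X Y → Y x → Nbr (X ∪ᵖ Y) x ≐ X ∪ᵖ Nbr Y x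
  Nbr-∪ʳ j y∈Y =
    (λ { (inj₂ p , e) → inj₂ (p , e) ; (inj₁ q , e) → inj₁ q }) ,
    (λ { (inj₂ (p , e)) → inj₂ p , e ; (inj₁ q) → inj₁ q , ∼-sym (j q y∈Y) })

  -- The shape shared by all parts of a join order: the list of one factor is kept, `R` from the
  -- other factor comes after it, and `f` joins each link with that factor.
  Sheds-extend : Joined X R → All X xs →
    (∀ {x A} → X x → Decomp m₁ k (Nbr X x) A → Decomp m₂ l (Nbr P x) (A ∪ᵖ R)) →
    Sheds X m₁ k T xs → Sheds P m₂ l (T ∪ᵖ R) xs
  Sheds-extend j [] f [] = []
  Sheds-extend {X = X} {R = R} {T = T} j (_∷_ {x} {xs} x∈X xs⊆X) f (d ∷ ss) =
    Decomp-resp ≐-refl eq (f x∈X d) ∷ Sheds-extend j xs⊆X f ss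
    where
    eq : Nbr ((_∈ˡ xs) ∪ᵖ T) x ∪ᵖ R ≐ Nbr ((_∈ˡ xs) ∪ᵖ (T ∪ᵖ R)) x
    eq = (λ { (inj₁ (inj₁ p , e)) → inj₁ p , e
            ; (inj₁ (inj₂ p , e)) → inj₂ (inj₁ p) , e
            ; (inj₂ r) → inj₂ (inj₂ r) , j x∈X r }) ,
         (λ { (inj₁ p , e) → inj₁ (inj₁ p , e)
            ; (inj₂ (inj₁ p) , e) → inj₁ (inj₂ p , e)
            ; (inj₂ (inj₂ r) , e) → inj₂ r })

  Sheds-snoc : Sheds P m k ((_≡ z) ∪ᵖ T) xs → Decomp m k (Nbr P z) (Nbr T z) →
               Sheds P m k T (xs ++ [ z ])
  Sheds-snoc {z = z} {T = T} ss d =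
    Sheds-++ (Sheds-resp ≐-refl
                (∪-cong ((λ { refl → here refl }) , (λ { (here p) → p })) ≐-refl) ss)
             (Decomp-resp ≐-refl (Nbr-cong (≐-sym []-∪)) d ∷ [])

  Final≐snoc : ∀ xs → Final xs z ≐ (_∈ˡ (xs ++ [ z ]))
  Final≐snoc xs =
    [ ∈-++⁺ˡ , (λ { refl → ∈-++⁺ʳ xs (here refl) }) ]′ ,
    (Sum.map id (λ { (here p) → p }) ∘ ∈-++⁻ xs)

  -- The two kinds need each other. In both join orders the last vertex of `X` sees a target inside
  -- `Y` only, and in the order for a target inside `Y` the earlier vertices of `X` see targets on
  -- both sides.
  JoinsWeak JoinsStrong : ℕ → ℕ → Set₁
  JoinsWeak k l = ∀ {m X A Y B} → Joined X Y →
    Decomp weak k X A → Decomp m l Y B → Decomp m (k + l) (X ∪ᵖ Y) (A ∪ᵖ B)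
  JoinsStrong k l = ∀ {X A Y B} → Joined X Y →
    Decomp weak k X A → Decomp strong l Y B → Decomp strong (k + l) (X ∪ᵖ Y) B

  private
    shift : ∀ k l → Decomp m (suc k + l) P W → Decomp m (k + suc l) P W
    shift {m} {P} {W} k l = subst (λ i → Decomp m i P W) (sym (ℕ.+-suc k l))

    ⊆⇒All : (_∈ˡ xs) ⊆ᵖ P → All P xs
    ⊆⇒All f = All.tabulate f

    decomp-⊆ : Decomp m k P W → W ⊆ᵖ P
    decomp-⊆ (empty _ ¬W) w = ⊥-elim (¬W w)
    decomp-⊆ (order xs ys z (_ , g) (h , _) _ _ _) w = g (inj₂ (h w))

    Nbr-≐ˡ : Joined X R → X x → Nbr R x ≐ R
    Nbr-≐ˡ j x∈X = proj₁ , λ r → r , j x∈X r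

    swap-≐ : P ∪ᵖ Q ≐ Q ∪ᵖ P
    swap-≐ = Sum.swap , Sum.swap

    Joined-Nbrˡ : Joined X Y → Joined (Nbr X x) Y
    Joined-Nbrˡ j (p , _) q = j p q

    Joined-Nbrʳ : Joined X Y → Joined X (Nbr Y x)
    Joined-Nbrʳ j p (q , _) = j p q

    fromStrong : Decomp strong k P W → Decomp m k P W
    fromStrong {m = weak}   d = weaken d
    fromStrong {m = strong} d = d

  -- The order on the join is X ∖ A, Y ∖ B, B ∖ ŷ, A, ŷ.
  weakStep : ∀ {k l} → JoinsWeak k (suc l) → JoinsWeak (suc k) l → JoinsStrong k (suc l) →
             JoinsWeak (suc k) (suc l)
  weakStep {k} {l} IHˣ IHʸ IHˢ {m} {X} {A} {Y} {B} j
    dX@(order xs xs′ x̂ (X⊆ , ⊆X) (A⊆ , ⊆A) ssX tsX d̂X)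
    dY@(order ys ys′ ŷ (Y⊆ , ⊆Y) (B⊆ , ⊆B) ssY tsY d̂Y) =
    order (xs ++ ys) (ys′ ++ (xs′ ++ [ x̂ ])) ŷ
      (exact→ , exact←) (final← , final→)
      (Sheds-++ (Sheds-resp ≐-refl (tail→ , tail←)
                   (Sheds-extend j (⊆⇒All (⊆X ∘ inj₁)) (λ x∈X d → fromX x∈X d (Decomp-all dY)) ssX))
                (Sheds-resp ≐-refl ([ final← ∘ inj₂ ∘ ⊆B , final← ∘ inj₁ ]′ ,
                                    [ inj₂ , inj₁ ∘ B⊆ ]′ ∘ final→)
                   (Sheds-extend Y~A (⊆⇒All (⊆Y ∘ inj₁)) fromY ssY)))
      (Sheds-++ (Sheds-resp ≐-refl (≐-trans swap-≐ (∪-cong A≐snoc ≐-refl))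
                   (Sheds-extend Y~A (⊆⇒All (⊆Y ∘ inj₂ ∘ inj₁)) fromY tsY))
                (Sheds-snoc
                   (Sheds-extend X~ŷ (⊆⇒All (⊆X ∘ inj₂ ∘ inj₁))
                      (λ x∈X d → fromX x∈X d (fromStrong ŷ-last)) tsX)
                   -- Only `ŷ` comes after `x̂`, so the target lies inside `Y`. As the last vertex
                   -- of `Y` it is strong whatever the mode of `dY`.
                   (Decomp-resp (≐-sym (Nbr-∪ˡ j x̂∈X)) (≐-sym (Nbr-≐ˡ X~ŷ x̂∈X))
                      (fromStrong (IHˢ (Joined-Nbrˡ j) d̂X ŷ-last)))))
      (Decomp-resp (≐-sym (Nbr-∪ʳ j ŷ∈Y)) (≐-sym (Nbr-∪ʳ j ŷ∈Y))
        (shift k l (IHʸ (Joined-Nbrʳ j) (Decomp-all dX) d̂Y)))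
    where
    final = ys′ ++ (xs′ ++ [ x̂ ])

    ŷ-last : Decomp strong (suc l) Y (_≡ ŷ)
    ŷ-last = Linear-last (toLinear dY)

    x̂∈X : X x̂
    x̂∈X = ⊆X (inj₂ (inj₂ refl))

    ŷ∈Y : Y ŷ
    ŷ∈Y = ⊆Y (inj₂ (inj₂ refl))

    Y~A : Joined Y A
    Y~A y a = ∼-sym (j (decomp-⊆ dX a) y)

    X~ŷ : Joined X (_≡ ŷ)
    X~ŷ x refl = j x ŷ∈Y

    A≐snoc : A ≐ (_∈ˡ (xs′ ++ [ x̂ ]))
    A≐snoc = ≐-trans (A⊆ , ⊆A) (Final≐snoc xs′)

    fromX : ∀ {m x A B} → X x → Decomp weak k (Nbr X x) A → Decomp m (suc l) Y B →
            Decomp m (k + suc l) (Nbr (X ∪ᵖ Y) x) (A ∪ᵖ B)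
    fromX x∈X d d′ = Decomp-resp (≐-sym (Nbr-∪ˡ j x∈X)) ≐-refl (IHˣ (Joined-Nbrˡ j) d d′)

    fromY : ∀ {m y B} → Y y → Decomp m l (Nbr Y y) B →
            Decomp m (k + suc l) (Nbr (X ∪ᵖ Y) y) (B ∪ᵖ A)
    fromY y∈Y d = Decomp-resp (≐-sym (Nbr-∪ʳ j y∈Y)) swap-≐
      (shift k l (IHʸ (Joined-Nbrʳ j) dX d))

    final→ : Final final ŷ ⊆ᵖ A ∪ᵖ B
    final→ (inj₂ p) = inj₂ (⊆B (inj₂ p))
    final→ (inj₁ p) = [ inj₂ ∘ ⊆B ∘ inj₁ , inj₁ ∘ proj₂ A≐snoc ]′ (∈-++⁻ ys′ p)

    final← : A ∪ᵖ B ⊆ᵖ Final final ŷ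
    final← (inj₁ a) = inj₁ (∈-++⁺ʳ ys′ (proj₁ A≐snoc a))
    final← (inj₂ b) = Sum.map₁ ∈-++⁺ˡ (B⊆ b)

    tail→ : Final xs′ x̂ ∪ᵖ Y ⊆ᵖ (_∈ˡ ys) ∪ᵖ Final final ŷ
    tail→ (inj₁ a) = inj₂ (final← (inj₁ (⊆A a)))
    tail→ (inj₂ y) = Sum.map₂ (final← ∘ inj₂ ∘ ⊆B) (Y⊆ y)

    tail← : (_∈ˡ ys) ∪ᵖ Final final ŷ ⊆ᵖ Final xs′ x̂ ∪ᵖ Y
    tail← (inj₁ p) = inj₂ (⊆Y (inj₁ p))
    tail← (inj₂ p) = Sum.map A⊆ (decomp-⊆ dY) (final→ p)

    exact→ : X ∪ᵖ Y ⊆ᵖ (_∈ˡ (xs ++ ys)) ∪ᵖ Final final ŷ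
    exact→ (inj₁ x) = Sum.map ∈-++⁺ˡ (final← ∘ inj₁ ∘ ⊆A) (X⊆ x)
    exact→ (inj₂ y) = Sum.map (∈-++⁺ʳ xs) (final← ∘ inj₂ ∘ ⊆B) (Y⊆ y)

    exact← : (_∈ˡ (xs ++ ys)) ∪ᵖ Final final ŷ ⊆ᵖ X ∪ᵖ Y
    exact← (inj₁ p) = Sum.map (⊆X ∘ inj₁) (⊆Y ∘ inj₁) (∈-++⁻ xs p)
    exact← (inj₂ p) = Sum.map (decomp-⊆ dX) (decomp-⊆ dY) (final→ p)

  -- The order on the join is Y ∖ B, X, B.
  strongStep : ∀ {k l} → JoinsWeak k (suc l) → JoinsWeak (suc k) l →
               JoinsStrong k (suc l) → JoinsStrong (suc k) l →
               JoinsStrong (suc k) (suc l)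
  strongStep {k} {l} IHˣ IHʸ IHˣˢ IHʸˢ {X} {A} {Y} {B} j dX
    dY@(order ys ys′ ŷ (Y⊆ , ⊆Y) (B⊆ , ⊆B) ssY tsY d̂Y) =
    order (ys ++ (init ++ [ last ])) ys′ ŷ
      ([ inj₁ ∘ ∈-++⁺ʳ ys ∘ proj₁ X≐snoc , [ inj₁ ∘ ∈-++⁺ˡ , inj₂ ]′ ∘ Y⊆ ]′ ,
       [ Sum.swap ∘ Sum.map (⊆Y ∘ inj₁) (proj₂ X≐snoc) ∘ ∈-++⁻ ys , inj₂ ∘ ⊆Y ∘ inj₂ ]′)
      (B⊆ , ⊆B)
      (Sheds-++ (Sheds-resp ≐-refl (≐-trans swap-≐ (∪-cong X≐snoc ≐-refl))
                   (Sheds-extend (Joined-sym j) (⊆⇒All (⊆Y ∘ inj₁))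
                      (λ y∈Y d → fromY y∈Y
                        (swap (shift k l (IHʸ (Joined-Nbrʳ j) (Decomp-all dX) d)))) ssY))
                (Sheds-snoc
                   (Sheds-extend X~B (⊆⇒All (proj₂ exact ∘ inj₁))
                      (λ x∈X d → fromX x∈X (IHˣ (Joined-Nbrˡ j) d (weaken dB))) sheds)
                   (Decomp-resp ≐-refl (≐-sym (Nbr-≐ˡ X~B last∈X))
                      (fromX last∈X (weaken (IHˣˢ (Joined-Nbrˡ j) link dB))))))
      (Sheds-resp ≐-refl (∪-emptyʳ λ ())
        -- All of `X` precedes `B`, so the links of `B` gain no target vertices from it and `R` is
        -- empty.
        (Sheds-extend {R = ∅ᵖ} (λ _ ()) (⊆⇒All (⊆Y ∘ inj₂ ∘ inj₁))
          (λ y∈Y d → fromY y∈Y (Decomp-resp ≐-refl (≐-sym (∪-emptyʳ λ ()))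
                       (shift k l (IHʸˢ (Joined-Nbrʳ j) dX d)))) tsY))
      (Decomp-resp (≐-sym (Nbr-∪ʳ j ŷ∈Y)) (≐-sym (Nbr-∪ʳ j ŷ∈Y))
        (shift k l (IHʸ (Joined-Nbrʳ j) (Decomp-all dX) d̂Y)))
    where
    open Linear (toLinear dX)

    dB : Decomp strong (suc l) Y (Final ys′ ŷ)
    dB = Decomp-resp ≐-refl (B⊆ , ⊆B) dY

    swap : ∀ {m n P Q R} → Decomp m n P (Q ∪ᵖ R) → Decomp m n P (R ∪ᵖ Q)
    swap = Decomp-resp ≐-refl swap-≐

    last∈X : X last
    last∈X = proj₂ exact (inj₂ refl)

    ŷ∈Y : Y ŷ
    ŷ∈Y = ⊆Y (inj₂ (inj₂ refl))

    X~B : Joined X (Final ys′ ŷ)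
    X~B x b = j x (⊆Y (inj₂ b))

    X≐snoc : X ≐ (_∈ˡ (init ++ [ last ]))
    X≐snoc = ≐-trans exact (Final≐snoc init)

    fromX : ∀ {m k x W} → X x → Decomp m k (Nbr X x ∪ᵖ Y) W → Decomp m k (Nbr (X ∪ᵖ Y) x) W
    fromX x∈X = Decomp-resp (≐-sym (Nbr-∪ˡ j x∈X)) ≐-refl

    fromY : ∀ {m k y W} → Y y → Decomp m k (X ∪ᵖ Nbr Y y) W → Decomp m k (Nbr (X ∪ᵖ Y) y) W
    fromY y∈Y = Decomp-resp (≐-sym (Nbr-∪ʳ j y∈Y)) ≐-refl

  -- Passing to the link of a vertex lowers the index of exactly one factor, so every call decreases
  -- `k` or `l`.
  join-weak   : ∀ k l → JoinsWeak k l
  join-strong : ∀ k l → JoinsStrong k l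

  join-weak zero l j (empty ¬X ¬A) dY =
    Decomp-resp (≐-sym (∪-emptyˡ ¬X)) (≐-sym (∪-emptyˡ ¬A)) dY
  join-weak (suc k) zero {X = X} {A} {Y} {B} j dX (empty ¬Y ¬B) =
    subst (λ i → Decomp weak i (X ∪ᵖ Y) (A ∪ᵖ B)) (sym (ℕ.+-identityʳ (suc k)))
      (Decomp-resp (≐-sym (∪-emptyʳ ¬Y)) (≐-sym (∪-emptyʳ ¬B)) dX)
  join-weak (suc k) (suc l) =
    weakStep (join-weak k (suc l)) (join-weak (suc k) l) (join-strong k (suc l))

  join-strong zero l j (empty ¬X _) dY = Decomp-resp (≐-sym (∪-emptyˡ ¬X)) ≐-refl dY
  -- Here `Y` would be empty, and an empty target over the nonempty `X` is exactly what strength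
  -- excludes.
  join-strong (suc k) zero j dX ()
  join-strong (suc k) (suc l) =
    strongStep (join-weak k (suc l)) (join-weak (suc k) l)
      (join-strong k (suc l)) (join-strong (suc k) l)

-- The order read off from a list

module Before {V : Set} (_≟_ : DecidableEquality V) where

  open DecMembership _≟_ using () renaming (_∈?_ to _∈ˡ?_)

  -- Repetitions are harmless: an element counts at its last occurrence.
  data _⊢_≺_ : List V → V → V → Set where
    here  : ∀ {x y xs} → y ∈ˡ xs → x ∉ˡ xs → (x ∷ xs) ⊢ x ≺ y
    there : ∀ {x y z xs} → xs ⊢ x ≺ y → (z ∷ xs) ⊢ x ≺ y

  private
    variable
      x y z : V
      xs ys : List V

  ≺-∈ˡ : xs ⊢ x ≺ y → x ∈ˡ xs
  ≺-∈ˡ (here _ _) = here refl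
  ≺-∈ˡ (there p)  = there (≺-∈ˡ p)

  ≺-∈ʳ : xs ⊢ x ≺ y → y ∈ˡ xs
  ≺-∈ʳ (here y∈ _) = there y∈
  ≺-∈ʳ (there p)   = there (≺-∈ʳ p)

  ≺-irrefl : ¬ xs ⊢ x ≺ x
  ≺-irrefl (here x∈ x∉) = x∉ x∈
  ≺-irrefl (there p)    = ≺-irrefl p

  ≺-trans : xs ⊢ x ≺ y → xs ⊢ y ≺ z → xs ⊢ x ≺ z
  ≺-trans (here y∈ _)  (here _ y∉)  = contradiction y∈ y∉
  ≺-trans (here _ x∉)  (there q)    = here (≺-∈ʳ q) x∉
  ≺-trans (there p)    (here _ y∉)  = contradiction (≺-∈ʳ p) y∉
  ≺-trans (there p)    (there q)    = there (≺-trans p q)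

  ≺-total : x ∈ˡ xs → y ∈ˡ xs → x ≢ y → xs ⊢ x ≺ y ⊎ xs ⊢ y ≺ x
  ≺-total {x} {z ∷ xs} {y} x∈ y∈ x≢y with x ∈ˡ? xs | y ∈ˡ? xs | x∈ | y∈
  ... | yes x∈′ | yes y∈′ | _         | _         = Sum.map there there (≺-total x∈′ y∈′ x≢y)
  ... | yes x∈′ | no  y∉  | _         | here refl = inj₂ (here x∈′ y∉)
  ... | yes _   | no  y∉  | _         | there y∈′ = contradiction y∈′ y∉
  ... | no  x∉  | yes y∈′ | here refl | _         = inj₁ (here y∈′ x∉)
  ... | no  x∉  | yes _   | there x∈′ | _         = contradiction x∈′ x∉
  ... | no  x∉  | no  _   | there x∈′ | _         = contradiction x∈′ x∉
  ... | no  _   | no  y∉  | _         | there y∈′ = contradiction y∈′ y∉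
  ... | no  _   | no  _   | here refl | here refl = contradiction refl x≢y

  ≺-++⁺ : ∀ xs → ys ⊢ x ≺ y → (xs ++ ys) ⊢ x ≺ y
  ≺-++⁺ []       p = p
  ≺-++⁺ (_ ∷ xs) p = there (≺-++⁺ xs p)

  ≺-++⁻ : ∀ xs → x ∈ˡ ys → (xs ++ ys) ⊢ x ≺ y → ys ⊢ x ≺ y
  ≺-++⁻ []       _  p           = p
  ≺-++⁻ (_ ∷ xs) x∈ (here _ x∉) = contradiction (∈-++⁺ʳ xs x∈) x∉
  ≺-++⁻ (_ ∷ xs) x∈ (there p)   = ≺-++⁻ xs x∈ p

  last-maximal : ∀ xs → ¬ (xs ++ [ z ]) ⊢ z ≺ y
  last-maximal []       (here () _)
  last-maximal []       (there ())
  last-maximal (_ ∷ xs) (here _ z∉) = z∉ (∈-++⁺ʳ xs (here refl))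
  last-maximal (_ ∷ xs) (there p)   = last-maximal xs p

  -- Supplies the first vertex of a target for the order condition. The head of the list will do
  -- only if it does not recur.
  ≺-least : ∀ xs z → ∃ λ w → w ∈ˡ (xs ++ [ z ]) ×
            (∀ {v} → v ∈ˡ (xs ++ [ z ]) → v ≡ w ⊎ (xs ++ [ z ]) ⊢ w ≺ v)
  ≺-least [] z = z , here refl , λ { (here p) → inj₁ p }
  ≺-least (x ∷ xs) z with x ∈ˡ? (xs ++ [ z ]) | ≺-least xs z
  ... | no x∉  | _ = x , here refl , λ { (here p) → inj₁ p ; (there v∈) → inj₂ (here v∈ x∉) }
  ... | yes x∈ | w , w∈ , least = w , there w∈ , Sum.map₂ there ∘
          λ { (here refl) → least x∈ ; (there v∈) → least v∈ }

-- From list decompositions to star decomposability in vertices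

module CliqueComplex
  {V : Set} (_∼_ : Rel V 0ℓ) (∼-sym : Symmetric _∼_) (∼-irrefl : ∀ {v} → ¬ v ∼ v)
  (_≟_ : DecidableEquality V)
  {N : ℕ} (label : V → Fin N) (elem : Fin N → V)
  (elem-label : ∀ v → elem (label v) ≡ v) (label-elem : ∀ i → label (elem i) ≡ i)
  where

  open Decomposition _∼_ ∼-sym
  open Before _≟_

  record Clique (P : Pred V 0ℓ) (S : Subset N) : Set where
    constructor clique
    field
      members  : ∀ {i} → i ∈ S → P (elem i)
      adjacent : ∀ {i j} → i ∈ S → j ∈ S → i ≡ j ⊎ elem i ∼ elem j
  open Clique

  CliquesOf : Pred V 0ℓ → Complex N → Set
  CliquesOf P X = ∀ S → Face X S ⇔ Clique P S

  private
    variable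
      P W : Pred V 0ℓ
      X : Complex N
      m : Mode
      k : ℕ
      i j : Fin N

  elem-injective : elem i ≡ elem j → i ≡ j
  elem-injective {i} {j} eq = trans (sym (label-elem i)) (trans (cong label eq) (label-elem j))

  vertex⁺ : CliquesOf P X → P (elem i) → IsVertex X i
  vertex⁺ {P = P} {i = i} X≗P p = from (X≗P ⁅ i ⁆) (clique
    (λ j∈ → subst (P ∘ elem) (sym (x∈⁅y⁆⇒x≡y i j∈)) p)
    (λ j∈ l∈ → inj₁ (trans (x∈⁅y⁆⇒x≡y i j∈) (sym (x∈⁅y⁆⇒x≡y i l∈)))))

  vertex⁻ : CliquesOf P X → IsVertex X i → P (elem i)
  vertex⁻ {i = i} X≗P v = members (to (X≗P ⁅ i ⁆) v) (x∈⁅x⁆ i)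

  lk-cliques : CliquesOf P X → IsVertex X i → CliquesOf (Nbr P (elem i)) (lk ⁅ i ⁆ X)
  lk-cliques {P = P} {X = X} {i = i} X≗P Xi S = mk⇔ cliqueOf faceOf
    where
    cliqueOf : Face (lk ⁅ i ⁆ X) S → Clique (Nbr P (elem i)) S
    cliqueOf (σ , Xσ , i⊆σ , refl) = clique
      (λ j∈ → members c (p─q⊆p σ _ j∈) ,
              [ (λ i≡j → contradiction (sym i≡j) (x∈p-y⇒x≢y σ i j∈)) , id ]′
                (adjacent c (i⊆σ (x∈⁅x⁆ i)) (p─q⊆p σ _ j∈)))
      (λ j∈ l∈ → adjacent c (p─q⊆p σ _ j∈) (p─q⊆p σ _ l∈))
      where
      c : Clique P σ
      c = to (X≗P σ) Xσ

    faceOf : Clique (Nbr P (elem i)) S → Face (lk ⁅ i ⁆ X) S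
    faceOf (clique mem adj) = S ∪ ⁅ i ⁆ , from (X≗P _) (clique mem′ adj′) , q⊆p∪q S ⁅ i ⁆ ,
      ⊆-antisym (λ j∈ → x∈p∧x≢y⇒x∈p-y (p⊆p∪q _ j∈) (j≢i j∈)) back
      where
      j≢i : j ∈ S → j ≢ i
      j≢i j∈ refl = ∼-irrefl (proj₂ (mem j∈))

      split : j ∈ S ∪ ⁅ i ⁆ → j ∈ S ⊎ j ≡ i
      split j∈ = Sum.map₂ (x∈⁅y⁆⇒x≡y i) (x∈p∪q⁻ S ⁅ i ⁆ j∈)

      back : (S ∪ ⁅ i ⁆) - i ⊆ S
      back j∈ with split (p─q⊆p (S ∪ ⁅ i ⁆) ⁅ i ⁆ j∈)
      ... | inj₁ j∈S = j∈S
      ... | inj₂ j≡i = contradiction j≡i (x∈p-y⇒x≢y (S ∪ ⁅ i ⁆) i j∈)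

      mem′ : j ∈ S ∪ ⁅ i ⁆ → P (elem j)
      mem′ j∈ with split j∈
      ... | inj₁ j∈S  = proj₁ (mem j∈S)
      ... | inj₂ refl = vertex⁻ {X = X} X≗P Xi

      adj′ : ∀ {j l} → j ∈ S ∪ ⁅ i ⁆ → l ∈ S ∪ ⁅ i ⁆ → j ≡ l ⊎ elem j ∼ elem l
      adj′ j∈ l∈ with split j∈ | split l∈
      ... | inj₁ j∈S  | inj₁ l∈S  = adj j∈S l∈S
      ... | inj₁ j∈S  | inj₂ refl = inj₂ (∼-sym (proj₂ (mem j∈S)))
      ... | inj₂ refl | inj₁ l∈S  = inj₂ (proj₂ (mem l∈S))
      ... | inj₂ refl | inj₂ refl = inj₁ refl

  -- A link recorded at an earlier occurrence of `v` is passed over; the one at the last occurrence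
  -- agrees with the order.
  Sheds-link : ∀ xs {z} → Sheds P m k (_≡ z) xs → ∀ {v} → v ∈ˡ (xs ++ [ z ]) → v ≢ z →
    Decomp m k (Nbr P v) (λ u → (xs ++ [ z ]) ⊢ v ≺ u × v ∼ u)
  Sheds-link [] [] (here refl) v≢z = contradiction refl v≢z
  Sheds-link (x ∷ xs) {z} (d ∷ ss) {v} v∈ v≢z
    with DecMembership._∈?_ _≟_ v (xs ++ [ z ]) | v∈
  ... | yes v∈′ | _ = Decomp-resp ≐-refl
        ((λ (p , e) → there p , e) ,
         (λ { (here _ v∉ , _) → contradiction v∈′ v∉ ; (there p , e) → p , e }))
        (Sheds-link xs ss v∈′ v≢z)
  ... | no v∉ | here refl = Decomp-resp ≐-refl
        ((λ (p , e) → here (proj₁ (Final≐snoc xs) p) v∉ , e) ,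
         (λ { (here u∈ _ , e) → proj₂ (Final≐snoc xs) u∈ , e
            ; (there p , _) → contradiction (≺-∈ˡ p) v∉ }))
        d
  ... | no v∉ | there v∈′ = contradiction v∈′ v∉

  Decomp-link : Decomp m (suc k) P W → ∀ {v} → P v → ∃ λ W′ → Decomp weak k (Nbr P v) W′
  Decomp-link d {v} p with toLinear d
  ... | linear xs z (P⊆ , _) ss d′ with v ≟ z
  ...   | yes refl = _ , d′
  ...   | no  v≢z  = _ , Sheds-link xs ss (proj₁ (Final≐snoc xs) (P⊆ p)) v≢z

  -- Purity is recovered from the decomposition: a facet without one of its vertices is a facet of
  -- the link of that vertex, and this link has a decomposition of index one less.
  facet-size : ∀ k {P W X φ} → Decomp m k P W → CliquesOf P X → Facet X φ → ∣ φ ∣ ≡ k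
  facet-size zero {φ = φ} (empty ¬P _) X≗P (Xφ , _) =
    trans (cong ∣_∣ (Empty-unique (λ (i , i∈) → ¬P (members (to (X≗P φ) Xφ) i∈)))) (∣⊥∣≡0 N)
  facet-size (suc k) {P} {X = X} {φ} d@(order _ _ z (_ , ⊆P) _ _ _ _) X≗P facet@(Xφ , max)
    with nonempty? φ
  ... | yes (i , i∈) =
        trans (sym (x∈p⇒1+∣p-x∣≡∣p∣ i∈))
          (cong suc (facet-size k {X = lk ⁅ i ⁆ X} (proj₂ (Decomp-link d Pi))
            (lk-cliques {X = X} X≗P (vertex⁺ {X = X} X≗P Pi)) (lk-facet X facet i∈)))
        where
        Pi : P (elem i)
        Pi = members (to (X≗P φ) Xφ) i∈
  -- The empty face is no facet, since `z` is a vertex.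
  ... | no ∄i = contradiction (label z , subst (label z ∈_) z≡φ (x∈⁅x⁆ _)) ∄i
        where
        Pz : P (elem (label z))
        Pz = subst P (sym (elem-label z)) (⊆P (inj₂ (inj₂ refl)))
        z≡φ : ⁅ label z ⁆ ≡ φ
        z≡φ = max ⁅ label z ⁆ (vertex⁺ {X = X} X≗P Pz) (λ x∈ → contradiction (_ , x∈) ∄i)

  hasDimension : Decomp m (suc k) P W → CliquesOf P X → HasDimension X (+ k)
  hasDimension {k = k} {X = X} d X≗P
    with facetAbove X {⊥} (from (X≗P ⊥) (clique (⊥-elim ∘ ∉⊥) (λ i∈ → ⊥-elim (∉⊥ i∈))))
  ... | φ , facet , _ =
        (φ , proj₁ facet , cong (λ i → + i -ℤ 1ℤ) (facet-size (suc k) {X = X} d X≗P facet)) , bound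
    where
    bound : ∀ σ → Face X σ → dim σ ≤ℤ + k
    bound σ Xσ with facetAbove X Xσ
    ... | ψ , facetψ , σ⊆ψ = ℤ.+-monoˡ-≤ -1ℤ
          (+≤+ (subst (∣ σ ∣ ≤_) (facet-size (suc k) {X = X} d X≗P facetψ) (p⊆q⇒∣p∣≤∣q∣ σ⊆ψ)))

  pure : Decomp m k P W → CliquesOf P X → Pure X
  pure {k = k} {X = X} d X≗P φ ψ facetφ facetψ = cong (λ i → + i -ℤ 1ℤ)
    (trans (facet-size k {X = X} d X≗P facetφ) (sym (facet-size k {X = X} d X≗P facetψ)))

  starDecomposable : ∀ k {P W X U} → Decomp weak k P W → CliquesOf P X →
                     (∀ i → U i ⇔ W (elem i)) → SdStarDecomposable X U
  starDecomposable zero {P} {X = X} (empty ¬P ¬W) X≗P U≗W = dim-1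
    (λ S → mk⇔ (λ XS → Empty-unique λ (i , i∈) → ¬P (Clique.members (to (X≗P S) XS) i∈))
               (λ { refl → from (X≗P ⊥) (clique (⊥-elim ∘ ∉⊥) (λ i∈ → ⊥-elim (∉⊥ i∈))) }))
    (λ i u → ¬W (to (U≗W i) u))
  starDecomposable (suc k) {P} {W} {X} {U} d@(order xs ys z P≐ W≐ _ _ _) X≗P U≗W =
    dim≥0 k (pure {X = X} d X≗P) (hasDimension {X = X} d X≗P) _≺_ strictTotalOrder
      orderCondition linkCondition lastCondition
    where
    open Linear (toLinear d)

    L : List V
    L = init ++ [ last ]

    P≐L : P ≐ (_∈ˡ L)
    P≐L = ≐-trans exact (Final≐snoc init)

    _≺_ : Rel (Fin N) 0ℓ
    i ≺ j = L ⊢ elem i ≺ elem j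

    vertex∈L : IsVertex X i → elem i ∈ˡ L
    vertex∈L v = proj₁ P≐L (vertex⁻ {X = X} X≗P v)

    total : IsVertex X i → IsVertex X j → i ≢ j → i ≺ j ⊎ j ≺ i
    total v v′ i≢j = ≺-total (vertex∈L v) (vertex∈L v′) (i≢j ∘ elem-injective)

    strictTotalOrder : IsStrictTotalOrder {A = ∃ (IsVertex X)} (_≡_ on proj₁) (_≺_ on proj₁)
    strictTotalOrder = record
      { isStrictPartialOrder = record
        { isEquivalence = record { refl = refl ; sym = sym ; trans = trans }
        ; irrefl        = λ { refl → ≺-irrefl }
        ; trans         = ≺-trans
        ; <-resp-≈      = (λ { refl p → p }) , (λ { refl p → p })
        }
      ; compare = compare
      }
      where
      compare : ∀ (a b : ∃ (IsVertex X)) →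
                Tri (proj₁ a ≺ proj₁ b) (proj₁ a ≡ proj₁ b) (proj₁ b ≺ proj₁ a)
      compare (i , v) (j , v′) with i Fin.≟ j
      ... | yes refl = tri≈ ≺-irrefl refl ≺-irrefl
      ... | no  i≢j with total v v′ i≢j
      ...   | inj₁ i≺j = tri< i≺j i≢j (≺-irrefl ∘ ≺-trans i≺j)
      ...   | inj₂ j≺i = tri> (≺-irrefl ∘ ≺-trans j≺i) i≢j j≺i

    final = ys ++ [ z ]

    L≡ : L ≡ xs ++ final
    L≡ = ++-assoc xs ys [ z ]

    orderCondition : ∃ λ w′ → IsVertex X w′ × (∀ i → U i ⇔ (IsVertex X i × (i ≡ w′ ⊎ w′ ≺ i)))
    orderCondition with ≺-least ys z
    ... | w , w∈ , least = label w , w′-vertex , λ i → mk⇔ (final⁺ i) (final⁻ i)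
      where
      W≐final : W ≐ (_∈ˡ final)
      W≐final = ≐-trans W≐ (Final≐snoc ys)

      W⊆P : W ⊆ᵖ P
      W⊆P = proj₂ P≐ ∘ inj₂ ∘ proj₁ W≐

      w′-vertex : IsVertex X (label w)
      w′-vertex = vertex⁺ {X = X} X≗P (subst P (sym (elem-label w)) (W⊆P (proj₂ W≐final w∈)))

      final⁺ : ∀ i → U i → IsVertex X i × (i ≡ label w ⊎ label w ≺ i)
      final⁺ i u = vertex⁺ {X = X} X≗P (W⊆P Wi) ,
        Sum.map (λ eq → trans (sym (label-elem i)) (cong label eq))
                (λ p → subst₂ (_⊢_≺ elem i) (sym L≡) (sym (elem-label w)) (≺-++⁺ xs p))
                (least (proj₁ W≐final Wi))
        where
        Wi : W (elem i)
        Wi = to (U≗W i) u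

      final⁻ : ∀ i → IsVertex X i × (i ≡ label w ⊎ label w ≺ i) → U i
      final⁻ i (_ , inj₁ refl) =
        from (U≗W i) (subst W (sym (elem-label w)) (proj₂ W≐final w∈))
      final⁻ i (_ , inj₂ w≺i) = from (U≗W i) (proj₂ W≐final (≺-∈ʳ (≺-++⁻ xs w∈
        (subst₂ (_⊢_≺ elem i) L≡ (elem-label w) w≺i))))

    last-isLast : ∀ {i} → IsVertex X i → elem i ≡ last → IsLast X _≺_ i
    last-isLast {i} v eq = v , λ j v′ → greatest j v′
      where
      greatest : ∀ j → IsVertex X j → j ≡ i ⊎ j ≺ i
      greatest j v′ with j Fin.≟ i
      ... | yes j≡i = inj₁ j≡i
      ... | no  j≢i = [ inj₂ , (λ i≺j → contradiction (subst (L ⊢_≺ elem j) eq i≺j)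
                                                     (last-maximal init)) ]′ (total v′ v j≢i)

    isLast-last : ∀ {i} → IsLast X _≺_ i → elem i ≡ last
    isLast-last {i} (_ , greatest) =
      [ (λ eq → trans (cong elem (sym eq)) (elem-label last)) ,
        (λ p → contradiction (subst (L ⊢_≺ elem i) (elem-label last) p) (last-maximal init)) ]′
      (greatest (label last)
        (vertex⁺ {X = X} X≗P (subst P (sym (elem-label last)) (proj₂ exact (inj₂ refl)))))

    linkCondition : ∀ w → IsVertex X w → ¬ IsLast X _≺_ w →
      SdStarDecomposable (lk ⁅ w ⁆ X) (λ v → IsVertex (lk ⁅ w ⁆ X) v × w ≺ v)
    linkCondition w v ¬last = starDecomposable k
      (Sheds-link init sheds (vertex∈L v) (¬last ∘ last-isLast v)) lk≗
      λ i → mk⇔ (λ (u , p) → p , proj₂ (vertex⁻ {X = lk ⁅ w ⁆ X} lk≗ u))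
                (λ (p , e) → vertex⁺ {X = lk ⁅ w ⁆ X} lk≗ (proj₂ P≐L (≺-∈ʳ p) , e) , p)
      where
      lk≗ : CliquesOf (Nbr P (elem w)) (lk ⁅ w ⁆ X)
      lk≗ = lk-cliques {X = X} X≗P v

    lastCondition : ∀ x → IsLast X _≺_ x →
      SdStarDecomposable (lk ⁅ x ⁆ X) (IsVertex (lk ⁅ x ⁆ X))
    lastCondition x isLast@(v , _) = starDecomposable k
      (subst (λ y → Decomp weak k (Nbr P y) (Nbr P y)) (sym (isLast-last isLast)) link) lk≗
      λ i → mk⇔ (vertex⁻ {X = lk ⁅ x ⁆ X} lk≗) (vertex⁺ {X = lk ⁅ x ⁆ X} lk≗)
      where
      lk≗ : CliquesOf (Nbr P (elem x)) (lk ⁅ x ⁆ X)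
      lk≗ = lk-cliques {X = X} X≗P v

-- Atoms above a face, and an enumeration of all subsets

private
  variable
    p q : Subset n
    x : Fin n

⊂-irrefl : ¬ p ⊂ p
⊂-irrefl (_ , _ , x∈ , x∉) = x∉ x∈

∪⁅⁆-⊆ : p ⊆ q → x ∈ q → p ∪ ⁅ x ⁆ ⊆ q
∪⁅⁆-⊆ {p = p} {q} {x} p⊆q x∈q y∈ =
  [ p⊆q , (λ y∈⁅x⁆ → subst (_∈ q) (sym (x∈⁅y⁆⇒x≡y x y∈⁅x⁆)) x∈q) ]′ (x∈p∪q⁻ p ⁅ x ⁆ y∈)

∈-∪⁅⁆⁻ : ∀ {y} → y ∈ p ∪ ⁅ x ⁆ → y ∈ p ⊎ y ≡ x
∈-∪⁅⁆⁻ {p = p} {x} y∈ = Sum.map₂ (x∈⁅y⁆⇒x≡y x) (x∈p∪q⁻ p ⁅ x ⁆ y∈)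

x∈p∪⁅x⁆ : ∀ (p : Subset n) x → x ∈ p ∪ ⁅ x ⁆
x∈p∪⁅x⁆ p x = q⊆p∪q p ⁅ x ⁆ (x∈⁅x⁆ x)

p⊂p∪⁅x⁆ : x ∉ p → p ⊂ p ∪ ⁅ x ⁆
p⊂p∪⁅x⁆ {x = x} {p} x∉p = p⊆p∪q ⁅ x ⁆ , x , x∈p∪⁅x⁆ p x , x∉p

∪⁅⁆-cancel-⊆ : x ∉ p → p ⊆ q ∪ ⁅ x ⁆ → p ⊆ q
∪⁅⁆-cancel-⊆ x∉p p⊆ y∈p with ∈-∪⁅⁆⁻ (p⊆ y∈p)
... | inj₁ y∈q  = y∈q
... | inj₂ refl = contradiction y∈p x∉p

∪⁅⁆-injective : x ∉ p → x ∉ q → p ∪ ⁅ x ⁆ ≡ q ∪ ⁅ x ⁆ → p ≡ q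
∪⁅⁆-injective {x = x} {p} {q} x∉p x∉q eq = ⊆-antisym
  (∪⁅⁆-cancel-⊆ x∉p (subst (p ⊆_) eq (p⊆p∪q ⁅ x ⁆)))
  (∪⁅⁆-cancel-⊆ x∉q (subst (q ⊆_) (sym eq) (p⊆p∪q ⁅ x ⁆)))

p∪⁅x⁆-x≡p : x ∉ p → (p ∪ ⁅ x ⁆) - x ≡ p
p∪⁅x⁆-x≡p {x = x} {p} x∉p = ⊆-antisym
  (∪⁅⁆-cancel-⊆ (λ x∈ → x∈p-y⇒x≢y (p ∪ ⁅ x ⁆) x x∈ refl) (p─q⊆p (p ∪ ⁅ x ⁆) ⁅ x ⁆))
  (λ y∈ → x∈p∧x≢y⇒x∈p-y (p⊆p∪q ⁅ x ⁆ y∈) (λ { refl → x∉p y∈ }))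

x∉p-x : ∀ (p : Subset n) x → x ∉ p - x
x∉p-x p x x∈ = x∈p-y⇒x≢y p x x∈ refl

p⊆q-x : p ⊆ q → x ∉ p → p ⊆ q - x
p⊆q-x p⊆q x∉p y∈p = x∈p∧x≢y⇒x∈p-y (p⊆q y∈p) (λ { refl → x∉p y∈p })

atom : p ⊂ q → q ⊆ p ∪ ⁅ x ⁆ → q ≡ p ∪ ⁅ x ⁆
atom (p⊆q , y , y∈q , y∉p) q⊆ with ∈-∪⁅⁆⁻ (q⊆ y∈q)
... | inj₁ y∈p  = contradiction y∈p y∉p
... | inj₂ refl = ⊆-antisym q⊆ (∪⁅⁆-⊆ p⊆q y∈q)

atom-minimal : p ⊂ q → ¬ q ⊂ p ∪ ⁅ x ⁆
atom-minimal p⊂q q⊂ with atom p⊂q (proj₁ q⊂)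
... | refl = ⊂-irrefl q⊂

p⊆q⇒p∪q─p≡q : p ⊆ q → p ∪ (q ─ p) ≡ q
p⊆q⇒p∪q─p≡q {p = p} {q} p⊆q = ⊆-antisym
  ([ p⊆q , p─q⊆p q p ]′ ∘ x∈p∪q⁻ p (q ─ p)) back
  where
  back : q ⊆ p ∪ (q ─ p)
  back {x} x∈q with x ∈? p
  ... | yes x∈p = x∈p∪q⁺ (inj₁ x∈p)
  ... | no  x∉p = x∈p∪q⁺ (inj₂ (x∈p∧x∉q⇒x∈p─q x∈q x∉p))

Disjoint : Subset n → Subset n → Set
Disjoint p q = ∀ {x} → x ∈ q → x ∉ p

disjoint⇒p∪q─p≡q : Disjoint p q → (p ∪ q) ─ p ≡ q
disjoint⇒p∪q─p≡q {p = p} {q} dis = ⊆-antisym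
  (λ x∈ → [ (λ x∈p → contradiction x∈p (x∈p─q⇒x∉q (p ∪ q) p x∈)) , id ]′
            (x∈p∪q⁻ p q (p─q⊆p (p ∪ q) p x∈)))
  (λ x∈q → x∈p∧x∉q⇒x∈p─q (q⊆p∪q p q x∈q) (dis x∈q))

-- Larger subsets come first: a cone is collapsed by removing `π` together with its join to the
-- apex, and this pair is free only once all larger `π` are gone.
descending : ∀ n → List (Subset n)
descending zero    = [ [] ]
descending (suc n) = map (inside ∷_) (descending n) ++ map (outside ∷_) (descending n)

∈-descending : (p : Subset n) → p ∈ˡ descending n
∈-descending []            = here refl
∈-descending (inside  ∷ p) = ∈-++⁺ˡ (∈-map⁺ (inside ∷_) (∈-descending p))
∈-descending (outside ∷ p) = ∈-++⁺ʳ _ (∈-map⁺ (outside ∷_) (∈-descending p))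

∷-⊈ : ∀ s → p ⊈ q → s ∷ p ⊈ s ∷ q
∷-⊈ s p⊈q sp⊆sq = p⊈q (drop-∷-⊆ sp⊆sq)

descending-⊈ : ∀ n → AllPairs _⊈_ (descending n)
descending-⊈ zero    = [] ∷ []
descending-⊈ (suc n) = AllPairs.++⁺ (half inside) (half outside)
  (All.tabulate λ p∈ → All.tabulate λ q∈ → cross (∈-map⁻ _ p∈) (∈-map⁻ _ q∈))
  where
  half : ∀ s → AllPairs _⊈_ (map (s ∷_) (descending n))
  half s = AllPairs.map⁺ (AllPairs.map (∷-⊈ s) (descending-⊈ n))

  cross : ∀ {p q} → (∃ λ p′ → p′ ∈ˡ descending n × p ≡ inside ∷ p′) →
          (∃ λ q′ → q′ ∈ˡ descending n × q ≡ outside ∷ q′) → p ⊈ q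
  cross (_ , _ , refl) (_ , _ , refl) p⊆q with p⊆q here
  ... | ()

-- Removals and collapses in face posets

_∼_ : Subset n → Subset n → Set
p ∼ q = p ⊂ q ⊎ q ⊂ p

module FacePoset {n : ℕ} where

  open Decomposition (_∼_ {n}) Sum.swap

  private
    variable
      F R R′ : Pred (Subset n) 0ℓ
      ρ σ τ a b : Subset n
      c : Fin n
      D k l : ℕ
      m : Mode

  -- The vertices of the subdivided link of `ρ` in `F`, each face of the link being enlarged by `ρ`.
  Upper : Pred (Subset n) 0ℓ → Subset n → Pred (Subset n) 0ℓ
  Upper F ρ τ = ρ ⊂ τ × F τ

  -- Written as an upper set in the boundary of the simplex `σ`, so that intervals fall under the
  -- same induction as the complex itself.
  Interval : Subset n → Subset n → Pred (Subset n) 0ℓ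
  Interval ρ σ = Upper (_⊂ σ) ρ

  -- Meant for faces of a link enlarged by `ρ`, with the empty face left out; a point thus shows up
  -- as the single set `b`.
  data CollapsesTo (b : Subset n) (R : Pred (Subset n) 0ℓ) : Set₁ where
    point : R ≐ (_≡ b) → CollapsesTo b R
    step  : ∀ {R′} σ τ → R σ → R τ → σ ⊂ τ → (∀ {π} → R π → σ ⊂ π → π ≡ τ) →
            R′ ≐ (λ π → R π × π ≢ σ × π ≢ τ) → CollapsesTo b R′ → CollapsesTo b R

  CollapsesTo-resp : R ≐ R′ → CollapsesTo b R → CollapsesTo b R′
  CollapsesTo-resp e (point e′) = point (≐-trans (≐-sym e) e′)
  CollapsesTo-resp (f , g) (step σ τ Rσ Rτ σ⊂τ unique e c) =
    step σ τ (f Rσ) (f Rτ) σ⊂τ (unique ∘ g)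
      (≐-trans e ((λ (r , r′) → f r , r′) , (λ (r , r′) → g r , r′))) c

  CollapsesTo-∋ : CollapsesTo b R → R b
  CollapsesTo-∋ (point (_ , g))               = g refl
  CollapsesTo-∋ (step _ _ _ _ _ _ (f , _) c) = proj₁ (f (CollapsesTo-∋ c))

  Lower : Pred (Subset n) 0ℓ → Subset n → Pred (Subset n) 0ℓ → Set
  Lower F ρ R = ∀ {π τ} → F π → R τ → ρ ⊂ π → π ⊂ τ → R π

  -- A free pair is closed upwards in `R`: whatever lies above `σ` is `τ`, so no remaining face
  -- contains a removed one.
  Lower-step : Lower F ρ R → σ ⊂ τ → (∀ {π} → R π → σ ⊂ π → π ≡ τ) →
               R′ ≐ (λ π → R π × π ≢ σ × π ≢ τ) → Lower F ρ R′
  Lower-step lower σ⊂τ unique (f , g) Fπ R′π′ ρ⊂π π⊂π′ with f R′π′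
  ... | Rπ′ , _ , π′≢τ = g (lower Fπ Rπ′ ρ⊂π π⊂π′ ,
          (λ { refl → π′≢τ (unique Rπ′ π⊂π′) }) ,
          (λ { refl → π′≢τ (unique Rπ′ (⊂-trans σ⊂τ π⊂π′)) }))

  record RemovalCollapse (F : Pred (Subset n) 0ℓ) (ρ b : Subset n)
                         (R : Pred (Subset n) 0ℓ) : Set₁ where
    field
      removed   : List (Subset n)
      removed⊆  : ∀ {φ} → φ ∈ˡ removed → Upper F ρ φ
      maximal   : ∀ {φ π} → φ ∈ˡ removed → F π → ¬ φ ⊂ π
      R⊆        : R ⊆ᵖ Upper F ρ
      cover     : Upper F ρ ⊆ᵖ (_∈ˡ removed) ∪ᵖ R
      collapses : CollapsesTo b R

    R-lower : Lower F ρ R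
    R-lower Fπ Rτ ρ⊂π π⊂τ with cover (ρ⊂π , Fπ)
    ... | inj₁ π∈ = contradiction π⊂τ (maximal π∈ (proj₂ (R⊆ Rτ)))
    ... | inj₂ Rπ = Rπ

  -- Here `D` is the common size of the facets, and `rc` lets the end of the collapse be prescribed.
  -- The links of free faces require that form.
  record HereditarilyRC (F : Pred (Subset n) 0ℓ) (D : ℕ) : Set₁ where
    field
      down    : ∀ {σ τ} → σ ⊆ τ → F τ → F σ
      bounded : ∀ {σ} → F σ → ∣ σ ∣ ≤ D
      full    : ∀ {σ} → F σ → ∃ λ φ → F φ × σ ⊆ φ × ∣ φ ∣ ≡ D
      rc      : ∀ {ρ c} → c ∉ ρ → F (ρ ∪ ⁅ c ⁆) → ∃ λ R → RemovalCollapse F ρ (ρ ∪ ⁅ c ⁆) R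

  -- The collapses of a cone with apex c over the boundary of φ, restricted to the faces above ρ.
  module Cone {ρ φ : Subset n} {c : Fin n} (c∉φ : c ∉ φ) where

    ConeOver : List (Subset n) → Pred (Subset n) 0ℓ
    ConeOver πs v = v ≡ ρ ∪ ⁅ c ⁆ ⊎
      (∃ λ π → (π ∈ˡ πs × ρ ⊂ π × π ⊂ φ) × (v ≡ π ⊎ v ≡ π ∪ ⁅ c ⁆))

    cone-collapse : ∀ {πs} → AllPairs _⊈_ πs → CollapsesTo (ρ ∪ ⁅ c ⁆) (ConeOver πs)
    cone-collapse [] = point ((λ { (inj₁ eq) → eq }) , inj₁)
    cone-collapse {π ∷ πs} (π⊈ ∷ ⊈s) with (ρ ⊂? π) ×-dec (π ⊂? φ)
    ... | no ¬between = CollapsesTo-resp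
            (Sum.map₂ (λ (π′ , (π′∈ , b) , eq) → π′ , (there π′∈ , b) , eq) ,
             Sum.map₂ λ { (π′ , (here refl , b) , eq) → contradiction b ¬between
                        ; (π′ , (there π′∈ , b) , eq) → π′ , (π′∈ , b) , eq })
            (cone-collapse ⊈s)
    -- No base left in the list contains `π`, so its only remaining proper coface is the join with
    -- the apex.
    ... | yes (ρ⊂π , π⊂φ) = step π (π ∪ ⁅ c ⁆)
            (inj₂ (π , (here refl , ρ⊂π , π⊂φ) , inj₁ refl))
            (inj₂ (π , (here refl , ρ⊂π , π⊂φ) , inj₂ refl))
            (p⊂p∪⁅x⁆ c∉π) unique
            ((λ r → Sum.map₂ (λ (π′ , (π′∈ , b) , eq) → π′ , (there π′∈ , b) , eq) r ,
                    ≢π r , ≢π∪c r) ,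
             λ { (inj₁ eq , _) → inj₁ eq
               ; (inj₂ (_ , (here refl , _) , inj₁ eq) , ≢π , _) → contradiction eq ≢π
               ; (inj₂ (_ , (here refl , _) , inj₂ eq) , _ , ≢) → contradiction eq ≢
               ; (inj₂ (π′ , (there π′∈ , b) , eq) , _) → inj₂ (π′ , (π′∈ , b) , eq) })
            (cone-collapse ⊈s)
      where
      c∉π : c ∉ π
      c∉π = c∉φ ∘ proj₁ π⊂φ

      unique : ∀ {v} → ConeOver (π ∷ πs) v → π ⊂ v → v ≡ π ∪ ⁅ c ⁆
      unique (inj₁ refl) π⊂v = ⊥-elim (⊂-irrefl (⊂-⊆-trans ρ⊂π (∪⁅⁆-cancel-⊆ c∉π (proj₁ π⊂v))))
      unique (inj₂ (_ , (here refl , _) , inj₁ refl)) π⊂v = ⊥-elim (⊂-irrefl π⊂v)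
      unique (inj₂ (_ , (here refl , _) , inj₂ refl)) π⊂v = refl
      unique (inj₂ (_ , (there π′∈ , _) , inj₁ refl)) π⊂v = ⊥-elim (All.lookup π⊈ π′∈ (proj₁ π⊂v))
      unique (inj₂ (_ , (there π′∈ , _) , inj₂ refl)) π⊂v =
        ⊥-elim (All.lookup π⊈ π′∈ (∪⁅⁆-cancel-⊆ c∉π (proj₁ π⊂v)))

      ≢π : ∀ {v} → ConeOver πs v → v ≢ π
      ≢π (inj₁ refl) eq = c∉π (subst (c ∈_) eq (x∈p∪⁅x⁆ _ c))
      ≢π (inj₂ (_ , (π∈ , _) , inj₁ refl)) refl = All.lookup π⊈ π∈ id
      ≢π (inj₂ (_ , _ , inj₂ refl)) eq = c∉π (subst (c ∈_) eq (x∈p∪⁅x⁆ _ c))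

      ≢π∪c : ∀ {v} → ConeOver πs v → v ≢ π ∪ ⁅ c ⁆
      ≢π∪c (inj₁ refl) eq =
        ⊂-irrefl (subst (_⊂ π) (∪⁅⁆-injective (c∉π ∘ proj₁ ρ⊂π) c∉π eq) ρ⊂π)
      ≢π∪c (inj₂ (_ , (_ , _ , π′⊂φ) , inj₁ refl)) eq =
        c∉φ (proj₁ π′⊂φ (subst (c ∈_) (sym eq) (x∈p∪⁅x⁆ _ c)))
      ≢π∪c (inj₂ (_ , (π′∈ , _ , π′⊂φ) , inj₂ refl)) eq =
        All.lookup π⊈ π′∈ (⊆-reflexive (sym (∪⁅⁆-injective (c∉φ ∘ proj₁ π′⊂φ) c∉π eq)))

  -- The boundary of `τ` without the facet `τ - c` is the cone with apex `c` over the boundary of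
  -- that facet. This serves twice: it gives the boundary of a simplex its hereditary property, and
  -- it makes that cone a strong target in the link of `τ` when `τ - c` is the free face `σ`.
  boundary-rc : c ∈ τ → ρ ⊂ τ - c →
    RemovalCollapse (_⊂ τ) ρ (ρ ∪ ⁅ c ⁆) (λ π → Interval ρ τ π × π ≢ τ - c)
  boundary-rc {c} {τ} {ρ} c∈τ ρ⊂φ@(ρ⊆φ , _) = record
    { removed   = [ φ ]
    ; removed⊆  = λ { (here refl) → ρ⊂φ , φ⊂τ }
    ; maximal   = λ { (here refl) π⊂τ φ⊂π → ℕ.<-irrefl refl
                      (ℕ.<-≤-trans (s≤s (p⊂q⇒∣p∣<∣q∣ φ⊂π))
                        (subst (suc _ ≤_) (sym (x∈p⇒1+∣p-x∣≡∣p∣ c∈τ)) (p⊂q⇒∣p∣<∣q∣ π⊂τ))) }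
    ; R⊆        = proj₁
    ; cover     = cover
    ; collapses = CollapsesTo-resp (cone→ , cone←) (cone-collapse (descending-⊈ n))
    }
    where
    φ : Subset n
    φ = τ - c

    φ⊂τ : φ ⊂ τ
    φ⊂τ = x∈p⇒p-x⊂p c∈τ

    c∉φ : c ∉ φ
    c∉φ = x∉p-x τ c

    open Cone {ρ} {φ} {c} c∉φ

    Target : Pred (Subset n) 0ℓ
    Target π = Interval ρ τ π × π ≢ φ

    cover : Interval ρ τ ⊆ᵖ (_∈ˡ [ φ ]) ∪ᵖ Target
    cover {π} i with π ≟ˢ φ
    ... | yes π≡φ = inj₁ (here π≡φ)
    ... | no  π≢φ = inj₂ (i , π≢φ)

    cone-target : ∀ {π} → ρ ⊆ π → π ⊂ φ → Target (π ∪ ⁅ c ⁆)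
    cone-target {π} ρ⊆π (π⊆φ , d , d∈φ , d∉π) =
      (⊆-⊂-trans ρ⊆π (p⊂p∪⁅x⁆ (c∉φ ∘ π⊆φ)) ,
       ∪⁅⁆-⊆ (proj₁ φ⊂τ ∘ π⊆φ) c∈τ , d , proj₁ φ⊂τ d∈φ ,
       [ d∉π , x∈p-y⇒x≢y τ c d∈φ ]′ ∘ ∈-∪⁅⁆⁻) ,
      λ eq → c∉φ (subst (c ∈_) eq (x∈p∪⁅x⁆ π c))

    cone→ : ConeOver (descending n) ⊆ᵖ Target
    cone→ (inj₁ refl) = cone-target id ρ⊂φ
    cone→ (inj₂ (π , (_ , ρ⊂π , π⊂φ) , inj₁ refl)) =
      (ρ⊂π , ⊂-trans π⊂φ φ⊂τ) , λ { refl → ⊂-irrefl π⊂φ }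
    cone→ (inj₂ (π , (_ , ρ⊂π , π⊂φ) , inj₂ refl)) = cone-target (proj₁ ρ⊂π) π⊂φ

    cone← : Target ⊆ᵖ ConeOver (descending n)
    cone← {v} ((ρ⊂v@(ρ⊆v , _) , (v⊆τ , d , d∈τ , d∉v)) , v≢φ) with c ∈? v
    ... | no c∉v = inj₂ (v , (∈-descending v , ρ⊂v ,
            [ (λ v≡φ → contradiction v≡φ v≢φ) , id ]′ (p⊆q⇒p≡q⊎p⊂q (p⊆q-x v⊆τ c∉v))) , inj₁ refl)
    ... | yes c∈v with p⊆q⇒p≡q⊎p⊂q (p⊆q-x ρ⊆v (c∉φ ∘ ρ⊆φ))
    ...   | inj₁ ρ≡v-c = inj₁ (sym (trans (cong (_∪ ⁅ c ⁆) ρ≡v-c) (p-x∪⁅x⁆≡p c∈v)))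
    ...   | inj₂ ρ⊂v-c = inj₂ (v - c , (∈-descending _ , ρ⊂v-c ,
              (λ x∈ → x∈p∧x≢y⇒x∈p-y (v⊆τ (p─q⊆p v ⁅ c ⁆ x∈)) (x∈p-y⇒x≢y v c x∈)) ,
              d , x∈p∧x≢y⇒x∈p-y d∈τ (λ { refl → d∉v c∈v }) , d∉v ∘ p─q⊆p v ⁅ c ⁆) ,
              inj₂ (sym (p-x∪⁅x⁆≡p c∈v)))

  boundary-HRC : ∣ σ ∣ ≡ suc D → HereditarilyRC (_⊂ σ) D
  boundary-HRC {σ} {D} ∣σ∣≡ = record
    { down    = ⊆-⊂-trans
    ; bounded = λ {π} π⊂σ → ℕ.≤-pred (subst (suc ∣ π ∣ ≤_) ∣σ∣≡ (p⊂q⇒∣p∣<∣q∣ π⊂σ))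
    ; full    = λ (π⊆σ , c , c∈σ , c∉π) →
        σ - c , x∈p⇒p-x⊂p c∈σ , p⊆q-x π⊆σ c∉π ,
        ℕ.suc-injective (trans (x∈p⇒1+∣p-x∣≡∣p∣ c∈σ) ∣σ∣≡)
    ; rc      = λ {ρ} {c} c∉ρ (ρc⊆σ , d , d∈σ , d∉ρc) →
        _ , boundary-rc (ρc⊆σ (x∈p∪⁅x⁆ ρ c))
              (p⊆q-x (ρc⊆σ ∘ p⊆p∪q ⁅ c ⁆) c∉ρ , d ,
               x∈p∧x≢y⇒x∈p-y d∈σ (λ { refl → d∉ρc (x∈p∪⁅x⁆ ρ c) }) , d∉ρc ∘ p⊆p∪q ⁅ c ⁆)
    }

  -- A free pair only asks for proper inclusion. Codimension one follows because `σ ∪ ⁅ c ⁆`, if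
  -- smaller than `τ`, would still be in `R` and is then equal to `τ` by uniqueness.
  free-coface : (∀ {π} → F π → ρ ⊂ π → π ⊂ τ → R π) → (∀ {σ τ} → σ ⊆ τ → F τ → F σ) →
    F τ → ρ ⊂ σ → σ ⊂ τ → (∀ {π} → R π → σ ⊂ π → π ≡ τ) → c ∈ τ → c ∉ σ → σ ∪ ⁅ c ⁆ ≡ τ
  free-coface {σ = σ} {c = c} lower down Fτ ρ⊂σ (σ⊆τ , _) unique c∈τ c∉σ
    with p⊆q⇒p≡q⊎p⊂q (∪⁅⁆-⊆ σ⊆τ c∈τ)
  ... | inj₁ eq   = eq
  ... | inj₂ σc⊂τ = unique (lower (down (proj₁ σc⊂τ) Fτ) (⊂-trans ρ⊂σ σ⊂σc) σc⊂τ) σ⊂σc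
    where
    σ⊂σc : σ ⊂ σ ∪ ⁅ c ⁆
    σ⊂σc = p⊂p∪⁅x⁆ c∉σ

  -- The induction on the dimension of the link

  -- `F` is quantified inside, so that the hypothesis covers the complex and the boundaries of its
  -- simplices. The target `R` serves the links of the faces `τ`, and the single vertex `b` those of
  -- the free faces `σ`.
  Decomposes : ℕ → Set₁
  Decomposes r = ∀ {F D ρ b R} → HereditarilyRC F D → F ρ → r + ∣ ρ ∣ ≡ D →
    RemovalCollapse F ρ b R → Decomp strong r (Upper F ρ) R × Decomp strong r (Upper F ρ) (_≡ b)

  Upper-empty : HereditarilyRC F ∣ ρ ∣ → ∀ {v} → ¬ Upper F ρ v
  Upper-empty h (ρ⊂v , Fv) =
    ℕ.<-irrefl refl (ℕ.<-≤-trans (p⊂q⇒∣p∣<∣q∣ ρ⊂v) (HereditarilyRC.bounded h Fv))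

  decomp-atom : Decomposes k → HereditarilyRC F D → c ∉ ρ → F (ρ ∪ ⁅ c ⁆) → k + ∣ ρ ∣ ≡ D →
    Decomp strong k (Upper F ρ) (_≡ ρ ∪ ⁅ c ⁆)
  decomp-atom {c = c} ih h c∉ρ Fρc eq =
    proj₂ (ih h (HereditarilyRC.down h (p⊆p∪q ⁅ c ⁆) Fρc) eq (proj₂ (HereditarilyRC.rc h c∉ρ Fρc)))

  decomp-all : Decomposes k → HereditarilyRC F D → F ρ → k + ∣ ρ ∣ ≡ D →
    Decomp weak k (Upper F ρ) (Upper F ρ)
  decomp-all {zero} ih h Fρ refl = empty (Upper-empty h) (Upper-empty h)
  decomp-all {suc k} {F = F} {ρ = ρ} ih h Fρ eq
    with HereditarilyRC.full h Fρ
  ... | φ , Fφ , ρ⊆φ , ∣φ∣≡D with p⊆q⇒p≡q⊎p⊂q ρ⊆φ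
  ...   | inj₁ refl = contradiction (trans ∣φ∣≡D (sym eq)) (ℕ.m≢1+n+m ∣ ρ ∣)
  ...   | inj₂ (_ , c , c∈φ , c∉ρ) =
          Decomp-all (decomp-atom ih h c∉ρ (HereditarilyRC.down h (∪⁅⁆-⊆ ρ⊆φ c∈φ) Fφ) eq)

  module Step {r : ℕ} (ih : ∀ {k} → k < suc r → Decomposes k)
    {F : Pred (Subset n) 0ℓ} {D : ℕ} (h : HereditarilyRC F D)
    {ρ : Subset n} (Fρ : F ρ) (rank : suc r + ∣ ρ ∣ ≡ D) where

    open HereditarilyRC h

    U : Pred (Subset n) 0ℓ
    U = Upper F ρ

    -- `s` and `t` are the indices (dimension plus one) of the factors of the link below and above
    -- `σ`. The vertex `σ` accounts for the difference between `s + t` and `suc r`.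
    record Ranks (σ : Subset n) : Set where
      constructor ranks
      field
        s t   : ℕ
        below : ∣ σ ∣ ≡ suc (s + ∣ ρ ∣)
        above : t + ∣ σ ∣ ≡ D
        total : r ≡ s + t

    ranksOf : ∀ {σ} → U σ → Ranks σ
    ranksOf {σ} (ρ⊂σ , Fσ) with ℕ.m≤n⇒∃[o]m+o≡n (p⊂q⇒∣p∣<∣q∣ ρ⊂σ) | ℕ.m≤n⇒∃[o]m+o≡n (bounded Fσ)
    ... | s , eq | t , eq′ = ranks s t
      (trans (sym eq) (cong suc (ℕ.+-comm ∣ ρ ∣ s)))
      (trans (ℕ.+-comm t ∣ σ ∣) eq′)
      (ℕ.+-cancelʳ-≡ (suc ∣ ρ ∣) r (s + t) (trans (ℕ.+-suc r ∣ ρ ∣) (trans rank (trans (sym eq′)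
        (trans (cong (_+ t) (sym eq))
          (solve 3 (λ p s t → con 1 :+ p :+ s :+ t := s :+ t :+ (con 1 :+ p)) refl ∣ ρ ∣ s t))))))

    U-link : ∀ {σ} → U σ → Interval ρ σ ∪ᵖ Upper F σ ≐ Nbr U σ
    U-link {σ} (ρ⊂σ , Fσ) =
      (λ { (inj₁ (ρ⊂v , v⊂σ)) → (ρ⊂v , down (proj₁ v⊂σ) Fσ) , inj₂ v⊂σ
         ; (inj₂ (σ⊂v , Fv)) → (⊂-trans ρ⊂σ σ⊂v , Fv) , inj₁ σ⊂v }) ,
      (λ { ((ρ⊂v , Fv) , inj₁ σ⊂v) → inj₂ (σ⊂v , Fv)
         ; ((ρ⊂v , Fv) , inj₂ v⊂σ) → inj₁ (ρ⊂v , v⊂σ) })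

    joined : ∀ {σ} → Joined (Interval ρ σ) (Upper F σ)
    joined (_ , π⊂σ) (σ⊂τ , _) = inj₁ (⊂-trans π⊂σ σ⊂τ)

    interval-all : ∀ {σ} → U σ → (rk : Ranks σ) →
      Decomp weak (Ranks.s rk) (Interval ρ σ) (Interval ρ σ)
    interval-all (ρ⊂σ , _) (ranks s t below above total) =
      decomp-all (ih (s≤s (subst (s ≤_) (sym total) (ℕ.m≤m+n s t))))
        (boundary-HRC below) ρ⊂σ refl

    link-above : ∀ {m σ B} → U σ → (∀ {t} → t < suc r → t + ∣ σ ∣ ≡ D → Decomp m t (Upper F σ) B) →
      Decomp m r (Nbr U σ) (Interval ρ σ ∪ᵖ B)
    link-above {m} {σ} {B} u d with ranksOf u
    ... | rk@(ranks s t below above total) =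
      subst (λ i → Decomp m i (Nbr U σ) (Interval ρ σ ∪ᵖ B)) (sym total)
        (Decomp-resp (U-link u) ≐-refl (join-weak s t joined (interval-all u rk)
          (d (s≤s (subst (t ≤_) (sym total) (ℕ.m≤n+m t s))) above)))

    -- For targets with no vertex above `τ`: by the time a collapse removes `τ`, every face above it
    -- has already gone. The join must therefore be the one whose target stays in one factor.
    link-below : ∀ {τ B} → U τ →
      (∀ {s} → s < suc r → ∣ τ ∣ ≡ suc (s + ∣ ρ ∣) → Decomp strong s (Interval ρ τ) B) →
      Decomp strong r (Nbr U τ) B
    link-below {τ} {B} u@(_ , Fτ) d with ranksOf u
    ... | ranks s t below above total =
      subst (λ i → Decomp strong i (Nbr U τ) B) (trans (ℕ.+-comm t s) (sym total))
        (Decomp-resp (≐-trans (Sum.swap , Sum.swap) (U-link u)) ≐-refl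
          (join-strong t s (Joined-sym joined)
            (decomp-all (ih (s≤s (subst (t ≤_) (sym total) (ℕ.m≤n+m t s)))) h Fτ above)
            (d (s≤s (subst (s ≤_) (sym total) (ℕ.m≤m+n s t))) below)))

    link-all : ∀ {σ} → U σ → Decomp weak r (Nbr U σ) (Nbr U σ)
    link-all u = Decomp-resp ≐-refl (U-link u)
      (link-above u (λ t< above → decomp-all (ih t<) h (proj₂ u) above))

    collapse-sheds : ∀ {b R} → R ⊆ᵖ U → Lower F ρ R →
      CollapsesTo b R → ∃ λ xs → R ≐ Final xs b × Sheds U strong r (_≡ b) xs
    collapse-sheds R⊆U lower (point e) = [] , ≐-trans e (≐-sym []-∪) , []
    collapse-sheds {b} {R} R⊆U lower
      (step {R′} σ τ Rσ Rτ σ⊂τ@(σ⊆τ , c , c∈τ , c∉σ) unique (R′⊆ , ⊆R′) coll)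
      with collapse-sheds (R⊆U ∘ proj₁ ∘ R′⊆) (Lower-step lower σ⊂τ unique (R′⊆ , ⊆R′)) coll
    ... | xs , (R′→ , →R′) , sheds =
      σ ∷ τ ∷ xs , (split , unsplit) , shed-σ ∷ shed-τ ∷ sheds
      where
      uσ : U σ
      uσ = R⊆U Rσ

      uτ : U τ
      uτ = R⊆U Rτ

      in-interval : ∀ {v} → R′ v → σ ∼ v → Interval ρ σ v
      in-interval R′v e with R′⊆ R′v | e
      ... | Rv , _ , v≢τ | inj₁ σ⊂v = contradiction (unique Rv σ⊂v) v≢τ
      ... | Rv , _ , _   | inj₂ v⊂σ = proj₁ (R⊆U Rv) , v⊂σ

      τ≡ : σ ∪ ⁅ c ⁆ ≡ τ
      τ≡ = free-coface (λ Fπ ρ⊂π π⊂τ → lower Fπ Rτ ρ⊂π π⊂τ) down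
             (proj₂ uτ) (proj₁ uσ) σ⊂τ unique c∈τ c∉σ

      σ≡ : τ - c ≡ σ
      σ≡ = trans (cong (_- c) (sym τ≡)) (p∪⁅x⁆-x≡p c∉σ)

      split : R ⊆ᵖ Final (σ ∷ τ ∷ xs) b
      split {v} Rv with v ≟ˢ σ | v ≟ˢ τ
      ... | yes refl | _        = inj₁ (here refl)
      ... | no _     | yes refl = inj₁ (there (here refl))
      ... | no v≢σ   | no v≢τ   = Sum.map₁ (λ v∈ → there (there v∈)) (R′→ (⊆R′ (Rv , v≢σ , v≢τ)))

      unsplit : Final (σ ∷ τ ∷ xs) b ⊆ᵖ R
      unsplit (inj₁ (here refl))         = Rσ
      unsplit (inj₁ (there (here refl))) = Rτ
      unsplit (inj₁ (there (there v∈)))  = proj₁ (R′⊆ (→R′ (inj₁ v∈)))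
      unsplit (inj₂ refl)                = proj₁ (R′⊆ (→R′ (inj₂ refl)))

      shed-σ : Decomp strong r (Nbr U σ) (Nbr ((_∈ˡ (τ ∷ xs)) ∪ᵖ (_≡ b)) σ)
      shed-σ = Decomp-resp ≐-refl (there-τ , back)
        (link-above uσ (λ t< above → decomp-atom-τ (ih t<) above))
        where
        decomp-atom-τ : ∀ {t} → Decomposes t → t + ∣ σ ∣ ≡ D → Decomp strong t (Upper F σ) (_≡ τ)
        -- This is the point that needs a prescribed end: the collapse in the link of `σ` has to
        -- finish at the atom `τ`.
        decomp-atom-τ dec above = subst (λ v → Decomp strong _ (Upper F σ) (_≡ v)) τ≡
          (decomp-atom dec h c∉σ (subst F (sym τ≡) (proj₂ uτ)) above)

        there-τ : Interval ρ σ ∪ᵖ (_≡ τ) ⊆ᵖ Nbr ((_∈ˡ (τ ∷ xs)) ∪ᵖ (_≡ b)) σ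
        there-τ (inj₂ refl) = inj₁ (here refl) , inj₁ σ⊂τ
        there-τ (inj₁ (ρ⊂v , v⊂σ)) =
          Sum.map₁ there (R′→ (⊆R′ (lower (down (proj₁ v⊂σ) (proj₂ uσ)) Rσ ρ⊂v v⊂σ ,
            (λ { refl → ⊂-irrefl v⊂σ }) , (λ { refl → ⊂-irrefl (⊂-trans v⊂σ σ⊂τ) })))) ,
          inj₂ v⊂σ

        back : Nbr ((_∈ˡ (τ ∷ xs)) ∪ᵖ (_≡ b)) σ ⊆ᵖ Interval ρ σ ∪ᵖ (_≡ τ)
        back (inj₁ (here v≡τ) , _) = inj₂ v≡τ
        back (inj₁ (there v∈) , e) = inj₁ (in-interval (→R′ (inj₁ v∈)) e)
        back (inj₂ v≡b , e)        = inj₁ (in-interval (→R′ (inj₂ v≡b)) e)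

      shed-τ : Decomp strong r (Nbr U τ) (Nbr (Final xs b) τ)
      shed-τ = Decomp-resp ≐-refl (forth , back) (link-below uτ
        (λ s< below → proj₁ (ih s< (boundary-HRC below) (proj₁ uτ) refl
          (boundary-rc c∈τ (subst (ρ ⊂_) (sym σ≡) (proj₁ uσ))))))
        where
        forth : (λ v → Interval ρ τ v × v ≢ τ - c) ⊆ᵖ Nbr (Final xs b) τ
        forth ((ρ⊂v , v⊂τ) , v≢) = R′→ (⊆R′ (lower (down (proj₁ v⊂τ) (proj₂ uτ)) Rτ ρ⊂v v⊂τ ,
          (λ v≡σ → v≢ (trans v≡σ (sym σ≡))) , (λ { refl → ⊂-irrefl v⊂τ }))) , inj₂ v⊂τ

        back : Nbr (Final xs b) τ ⊆ᵖ (λ v → Interval ρ τ v × v ≢ τ - c)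
        back (v∈ , e) with R′⊆ (→R′ v∈) | e
        ... | Rv , v≢σ , v≢τ | inj₁ τ⊂v = contradiction (unique Rv (⊂-trans σ⊂τ τ⊂v)) v≢τ
        ... | Rv , v≢σ , v≢τ | inj₂ v⊂τ = (proj₁ (R⊆U Rv) , v⊂τ) , λ v≡ → v≢σ (trans v≡ σ≡)

    decompose : ∀ {b R} → RemovalCollapse F ρ b R →
      Decomp strong (suc r) U R × Decomp strong (suc r) U (_≡ b)
    decompose {b} {R} rcR with collapse-sheds R⊆ R-lower collapses
      where open RemovalCollapse rcR
    ... | ys , R≐ , sheds = d , Linear-last (toLinear d)
      where
      open RemovalCollapse rcR

      -- Removed faces are maximal, so the neighbours of `φ` are proper faces of it that were not
      -- removed. All of them come later, and the target is the whole link.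
      removed-sheds : ∀ {φs} → (_∈ˡ φs) ⊆ᵖ (_∈ˡ removed) → Sheds U weak r (Final ys b) φs
      removed-sheds {[]}     _    = []
      removed-sheds {φ ∷ φs} sub =
        Decomp-resp ≐-refl (forth , back) (link-all uφ) ∷ removed-sheds (sub ∘ there)
        where
        uφ : U φ
        uφ = removed⊆ (sub (here refl))

        forth : Nbr U φ ⊆ᵖ Nbr ((_∈ˡ φs) ∪ᵖ Final ys b) φ
        forth ((ρ⊂v , Fv) , inj₁ φ⊂v) = contradiction φ⊂v (maximal (sub (here refl)) Fv)
        forth (u , inj₂ v⊂φ) with cover u
        ... | inj₁ v∈ = contradiction v⊂φ (maximal v∈ (proj₂ uφ))
        ... | inj₂ Rv = inj₂ (proj₁ R≐ Rv) , inj₂ v⊂φ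

        back : Nbr ((_∈ˡ φs) ∪ᵖ Final ys b) φ ⊆ᵖ Nbr U φ
        back (inj₁ v∈ , e) = removed⊆ (sub (there v∈)) , e
        back (inj₂ v∈ , e) = R⊆ (proj₂ R≐ v∈) , e

      d : Decomp strong (suc r) U R
      d = order removed ys b
        (Sum.map₂ (proj₁ R≐) ∘ cover , [ removed⊆ , R⊆ ∘ proj₂ R≐ ]′)
        R≐ (removed-sheds id) sheds (link-all (R⊆ (CollapsesTo-∋ collapses)))

  decomposes : ∀ r → Decomposes r
  decomposes = <-rec Decomposes λ
    { zero    ih h Fρ refl rcR →
        let open RemovalCollapse rcR in ⊥-elim (Upper-empty h (R⊆ (CollapsesTo-∋ collapses)))
    ; (suc r) ih h Fρ eq rcR → Step.decompose ih h Fρ eq rcR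
    }

  -- Changing the end of a collapse

  -- A free pair removing the target vertex σ is a leaf edge τ = {σ , a}: the rest collapses to a
  -- instead, and swapping a for σ at the end gives a collapse to σ.
  add-leaf : ∀ {a σ τ} →
    (∀ {π} → ρ ⊂ π → π ⊂ τ → π ≡ a ⊎ π ≡ σ) → (∀ {π} → ρ ⊂ π → ¬ π ⊂ σ) →
    σ ⊂ τ → a ⊂ τ → ∀ {R} → R ⊆ᵖ (ρ ⊂_) → ¬ R σ → ¬ R τ →
    CollapsesTo a R → CollapsesTo σ (R ∪ᵖ ((_≡ σ) ∪ᵖ (_≡ τ)))
  add-leaf {a = a} {σ} {τ} below atomic σ⊂τ a⊂τ R⊆ ¬Rσ ¬Rτ (point (e , e′)) =
    step a τ (inj₁ (e′ refl)) (inj₂ (inj₂ refl)) a⊂τ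
      (λ { (inj₁ r) a⊂π → contradiction (subst (a ⊂_) (e r) a⊂π) ⊂-irrefl
         ; (inj₂ (inj₁ refl)) a⊂σ → contradiction a⊂σ (atomic (R⊆ (e′ refl)))
         ; (inj₂ (inj₂ π≡τ)) _ → π≡τ })
      ((λ { refl → inj₂ (inj₁ refl) ,
                   (λ { refl → ¬Rσ (e′ refl) }) , (λ { refl → ⊂-irrefl σ⊂τ }) }) ,
       (λ { (inj₁ r , π≢a , _) → contradiction (e r) π≢a
          ; (inj₂ (inj₁ π≡σ) , _) → π≡σ
          ; (inj₂ (inj₂ π≡τ) , _ , π≢τ) → contradiction π≡τ π≢τ }))
      (point ≐-refl)
  add-leaf {a = a} {σ} {τ} below atomic σ⊂τ a⊂τ {R} R⊆ ¬Rσ ¬Rτ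
    (step {R′} σ′ τ′ Rσ′ Rτ′ σ′⊂τ′ unique (f , g) coll) =
    step σ′ τ′ (inj₁ Rσ′) (inj₁ Rτ′) σ′⊂τ′
      (λ { (inj₁ r) σ′⊂π → unique r σ′⊂π
         ; (inj₂ (inj₁ refl)) σ′⊂σ → contradiction σ′⊂σ (atomic (R⊆ Rσ′))
         ; (inj₂ (inj₂ refl)) σ′⊂τ → ⊥-elim (not-below (below (R⊆ Rσ′) σ′⊂τ)) })
      ((λ { (inj₁ r) → let r′ , ≢ = f r in inj₁ r′ , ≢
          ; (inj₂ (inj₁ refl)) → inj₂ (inj₁ refl) ,
              (λ { refl → ¬Rσ Rσ′ }) , (λ { refl → ¬Rσ Rτ′ })
          ; (inj₂ (inj₂ refl)) → inj₂ (inj₂ refl) ,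
              (λ { refl → ¬Rτ Rσ′ }) , (λ { refl → ¬Rτ Rτ′ }) }) ,
       (λ { (inj₁ r , ≢) → inj₁ (g (r , ≢)) ; (inj₂ eq , _) → inj₂ eq }))
      (add-leaf below atomic σ⊂τ a⊂τ (R⊆ ∘ proj₁ ∘ f) (¬Rσ ∘ proj₁ ∘ f) (¬Rτ ∘ proj₁ ∘ f) coll)
    where
    not-below : ¬ (σ′ ≡ a ⊎ σ′ ≡ σ)
    not-below (inj₁ refl) = proj₁ (proj₂ (f (CollapsesTo-∋ coll))) refl
    not-below (inj₂ refl) = ¬Rσ Rσ′

  below-edge : ∀ {ρ π : Subset n} {c e : Fin n} →
    ρ ⊂ π → π ⊂ (ρ ∪ ⁅ c ⁆) ∪ ⁅ e ⁆ → π ≡ ρ ∪ ⁅ e ⁆ ⊎ π ≡ ρ ∪ ⁅ c ⁆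
  below-edge {ρ} {π} {c} {e} ρ⊂π@(ρ⊆π , _) (π⊆ , x , x∈ , x∉π) with ∈-∪⁅⁆⁻ x∈
  ... | inj₂ refl = inj₂ (atom ρ⊂π (∪⁅⁆-cancel-⊆ x∉π π⊆))
  ... | inj₁ x∈ρc with ∈-∪⁅⁆⁻ x∈ρc
  ...   | inj₁ x∈ρ  = contradiction (ρ⊆π x∈ρ) x∉π
  ...   | inj₂ refl = inj₁ (atom ρ⊂π λ y∈π → remove (π⊆ y∈π) λ { refl → x∉π y∈π })
    where
    remove : ∀ {y} → y ∈ (ρ ∪ ⁅ c ⁆) ∪ ⁅ e ⁆ → y ≢ c → y ∈ ρ ∪ ⁅ e ⁆
    remove y∈ y≢c with ∈-∪⁅⁆⁻ y∈
    ... | inj₂ refl = x∈p∪⁅x⁆ ρ e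
    ... | inj₁ y∈ρc = [ p⊆p∪q ⁅ e ⁆ , (λ y≡c → contradiction y≡c y≢c) ]′ (∈-∪⁅⁆⁻ y∈ρc)

  retarget : (∀ {σ τ} → σ ⊆ τ → F τ → F σ) → R ⊆ᵖ Upper F ρ →
    Lower F ρ R →
    CollapsesTo a R → ∀ {c} → c ∉ ρ → R (ρ ∪ ⁅ c ⁆) → CollapsesTo (ρ ∪ ⁅ c ⁆) R
  retarget down R⊆ lower (point e) c∉ρ Rρc =
    subst (λ v → CollapsesTo v _) (sym (proj₁ e Rρc)) (point e)
  retarget {F = F} {R = R} {ρ = ρ} down R⊆ lower
    (step {R′} σ τ Rσ Rτ σ⊂τ@(σ⊆τ , e , e∈τ , e∉σ) unique R′≐@(f , g) coll) {c} c∉ρ Rρc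
    with (ρ ∪ ⁅ c ⁆) ≟ˢ σ
  ... | no ρc≢σ = step σ τ Rσ Rτ σ⊂τ unique R′≐
          (retarget down (R⊆ ∘ proj₁ ∘ f) (Lower-step lower σ⊂τ unique R′≐) coll c∉ρ
            -- The chosen vertex cannot be `τ` either, since no `σ` fits strictly between `ρ` and an
            -- atom above it.
            (g (Rρc , ρc≢σ , λ { refl → atom-minimal (proj₁ (R⊆ Rσ)) σ⊂τ })))
  ... | yes refl with free-coface (λ Fπ ρ⊂π π⊂τ → lower Fπ Rτ ρ⊂π π⊂τ) down (proj₂ (R⊆ Rτ))
                        (p⊂p∪⁅x⁆ c∉ρ) σ⊂τ unique e∈τ e∉σ
  ...   | refl = CollapsesTo-resp
          ([ proj₁ ∘ f , [ (λ { refl → Rσ }) , (λ { refl → Rτ }) ]′ ]′ , split)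
          (add-leaf below-edge atom-minimal σ⊂τ ρe⊂τ (proj₁ ∘ R⊆ ∘ proj₁ ∘ f)
            (λ r → proj₁ (proj₂ (f r)) refl) (λ r → proj₂ (proj₂ (f r)) refl)
            (retarget down (R⊆ ∘ proj₁ ∘ f) (Lower-step lower σ⊂τ unique R′≐) coll e∉ρ R′ρe))
    where
    e∉ρ : e ∉ ρ
    e∉ρ = e∉σ ∘ p⊆p∪q ⁅ c ⁆

    c∉ρe : c ∉ ρ ∪ ⁅ e ⁆
    c∉ρe = [ c∉ρ , (λ { refl → e∉σ (x∈p∪⁅x⁆ ρ c) }) ]′ ∘ ∈-∪⁅⁆⁻

    ρe⊂τ : ρ ∪ ⁅ e ⁆ ⊂ τ
    ρe⊂τ = ∪⁅⁆-⊆ (σ⊆τ ∘ p⊆p∪q ⁅ c ⁆) e∈τ , c , σ⊆τ (x∈p∪⁅x⁆ ρ c) , c∉ρe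

    R′ρe : R′ (ρ ∪ ⁅ e ⁆)
    R′ρe = g (lower (down (proj₁ ρe⊂τ) (proj₂ (R⊆ Rτ))) Rτ (p⊂p∪⁅x⁆ e∉ρ) ρe⊂τ ,
              (λ eq → e∉σ (subst (e ∈_) eq (x∈p∪⁅x⁆ ρ e))) ,
              (λ eq → ⊂-irrefl (subst (_⊂ τ) eq ρe⊂τ)))

    split : R ⊆ᵖ R′ ∪ᵖ ((_≡ ρ ∪ ⁅ c ⁆) ∪ᵖ (_≡ τ))
    split {v} Rv with v ≟ˢ (ρ ∪ ⁅ c ⁆) | v ≟ˢ τ
    ... | yes p | _     = inj₂ (inj₁ p)
    ... | no _  | yes p = inj₂ (inj₂ p)
    ... | no p  | no q  = inj₁ (g (Rv , p , q))

  Above : Subset n → Pred (Subset n) 0ℓ → Pred (Subset n) 0ℓ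
  Above ρ G v = ρ ⊂ v × G (v ─ ρ)

  -- Adding `ρ` to the faces carries a collapse of the link over to the faces above `ρ`. The empty
  -- face becomes `ρ` itself and drops out; free faces are nonempty, so every pair survives.
  above-collapse : ∀ {G} → G ⊆ᵖ Disjoint ρ → Collapsible G →
    ∃ λ c → c ∉ ρ × CollapsesTo (ρ ∪ ⁅ c ⁆) (Above ρ G)
  above-collapse {ρ = ρ} {G} dis (point v faces) = v , v∉ρ , point (forth , back)
    where
    Gv : G ⁅ v ⁆
    Gv = from (faces ⁅ v ⁆) (inj₂ refl)

    v∉ρ : v ∉ ρ
    v∉ρ = dis Gv (x∈⁅x⁆ v)

    forth : Above ρ G ⊆ᵖ (_≡ ρ ∪ ⁅ v ⁆)
    forth {w} (ρ⊂w , Gw) with to (faces (w ─ ρ)) Gw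
    ... | inj₂ eq = trans (sym (p⊆q⇒p∪q─p≡q (proj₁ ρ⊂w))) (cong (ρ ∪_) eq)
    ... | inj₁ eq = contradiction
          (subst (ρ ⊂_) (trans (sym (p⊆q⇒p∪q─p≡q (proj₁ ρ⊂w)))
                               (trans (cong (ρ ∪_) eq) (∪-identityʳ ρ))) ρ⊂w)
          ⊂-irrefl

    back : (_≡ ρ ∪ ⁅ v ⁆) ⊆ᵖ Above ρ G
    back refl = p⊂p∪⁅x⁆ v∉ρ , subst G (sym (disjoint⇒p∪q─p≡q (dis Gv))) Gv
  above-collapse {ρ = ρ} {G} dis (collapse σ τ free coll) with above-collapse (dis ∘ proj₁) coll
  ... | c , c∉ρ , c↘ = c , c∉ρ , step (ρ ∪ σ) (ρ ∪ τ)
          (above σ∈F nonempty) (above τ∈F τ-nonempty) ρσ⊂ρτ uniq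
          ((λ (ρ⊂v , Gv , v∉) → (ρ⊂v , Gv) ,
              (λ { refl → v∉ (here (disjoint⇒p∪q─p≡q (dis σ∈F))) }) ,
              (λ { refl → v∉ (there (here (disjoint⇒p∪q─p≡q (dis τ∈F)))) })) ,
           (λ ((ρ⊂v , Gv) , v≢ρσ , v≢ρτ) → ρ⊂v , Gv ,
              λ { (here eq)         → v≢ρσ (restore ρ⊂v eq)
                ; (there (here eq)) → v≢ρτ (restore ρ⊂v eq) }))
          c↘
    where
    open Free free

    restore : ∀ {v π} → ρ ⊂ v → v ─ ρ ≡ π → v ≡ ρ ∪ π
    restore ρ⊂v eq = trans (sym (p⊆q⇒p∪q─p≡q (proj₁ ρ⊂v))) (cong (ρ ∪_) eq)

    τ-nonempty : Nonempty τ
    τ-nonempty = proj₁ nonempty , proj₁ σ⊂τ (proj₂ nonempty)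

    above : ∀ {π} → G π → Nonempty π → Above ρ G (ρ ∪ π)
    above {π} Gπ (x , x∈) = (p⊆p∪q π , x , q⊆p∪q ρ π x∈ , dis Gπ x∈) ,
      subst G (sym (disjoint⇒p∪q─p≡q (dis Gπ))) Gπ

    ρσ⊂ρτ : ρ ∪ σ ⊂ ρ ∪ τ
    ρσ⊂ρτ with σ⊂τ
    ... | σ⊆τ , x , x∈τ , x∉σ = (x∈p∪q⁺ ∘ Sum.map₂ σ⊆τ ∘ x∈p∪q⁻ ρ σ) ,
          x , q⊆p∪q ρ τ x∈τ , [ dis τ∈F x∈τ , x∉σ ]′ ∘ x∈p∪q⁻ ρ σ

    uniq : ∀ {π} → Above ρ G π → ρ ∪ σ ⊂ π → π ≡ ρ ∪ τ
    uniq {π} (ρ⊂π , Gπ) (ρσ⊆π , x , x∈π , x∉ρσ) = restore ρ⊂π (unique (π ─ ρ) Gπ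
      ((λ y∈σ → x∈p∧x∉q⇒x∈p─q (ρσ⊆π (q⊆p∪q ρ σ y∈σ)) (dis σ∈F y∈σ)) ,
       x , x∈p∧x∉q⇒x∈p─q x∈π (x∉ρσ ∘ p⊆p∪q σ) , x∉ρσ ∘ q⊆p∪q ρ σ))

-- From (HRC) to the face poset of the complex

module _ {n : ℕ} (K : Complex n) where

  open FacePoset {n}
  open Decomposition (_∼_ {n}) Sum.swap

  lk-face⁺ : ∀ {ρ σ} → Face K σ → ρ ⊆ σ → Face (lk ρ K) (σ ─ ρ)
  lk-face⁺ {σ = σ} Kσ ρ⊆σ = σ , Kσ , ρ⊆σ , refl

  lk-face⁻ : ∀ {ρ π} → Face (lk ρ K) π → Face K (ρ ∪ π) × Disjoint ρ π
  lk-face⁻ {ρ} (σ , Kσ , ρ⊆σ , refl) =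
    subst (Face K) (sym (p⊆q⇒p∪q─p≡q ρ⊆σ)) Kσ , x∈p─q⇒x∉q σ ρ

  module _ {ρ c} (c∉ρ : c ∉ ρ) (Kρc : Face K (ρ ∪ ⁅ c ⁆)) where

    private
      G = Face (lk ρ K)

    link-vertex : G ⁅ c ⁆
    link-vertex = subst G (disjoint⇒p∪q─p≡q (λ x∈ → subst (_∉ ρ) (sym (x∈⁅y⁆⇒x≡y c x∈)) c∉ρ))
      (lk-face⁺ Kρc (p⊆p∪q ⁅ c ⁆))

    link-RC : ∀ φs → All (Facet (lk ρ K)) φs → Collapsible (G ∖ φs) →
      ∃ λ a → RemovalCollapse (Face K) ρ (ρ ∪ ⁅ a ⁆) (Above ρ (G ∖ φs))
    link-RC φs facets coll with above-collapse (proj₂ ∘ lk-face⁻ ∘ proj₁) coll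
    ... | a , a∉ρ , a↘ = a , record
      { removed   = map (ρ ∪_) φs
      ; removed⊆  = removed⊆
      ; maximal   = maximal
      ; R⊆        = λ (ρ⊂v , Gv , _) →
          ρ⊂v , subst (Face K) (p⊆q⇒p∪q─p≡q (proj₁ ρ⊂v)) (proj₁ (lk-face⁻ Gv))
      ; cover     = cover
      ; collapses = a↘
      }
      where
      removed⊆ : ∀ {φ} → φ ∈ˡ map (ρ ∪_) φs → Upper (Face K) ρ φ
      removed⊆ φ∈ with ∈-map⁻ (ρ ∪_) φ∈
      ... | π , π∈ , refl with All.lookup facets π∈ | nonempty? π
      ...   | Gπ , _   | yes (x , x∈) =
              (p⊆p∪q π , x , q⊆p∪q ρ π x∈ , proj₂ (lk-face⁻ Gπ) x∈) , proj₁ (lk-face⁻ Gπ)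
      -- An empty facet would lie below the vertex `c` of the link.
      ...   | _  , max | no ∄x = ⊥-elim (∄x (c ,
              subst (c ∈_) (max ⁅ c ⁆ link-vertex (λ x∈ → ⊥-elim (∄x (_ , x∈)))) (x∈⁅x⁆ c)))

      maximal : ∀ {φ π} → φ ∈ˡ map (ρ ∪_) φs → Face K π → ¬ φ ⊂ π
      maximal {π = π} φ∈ Kπ φ⊂π with ∈-map⁻ (ρ ∪_) φ∈
      ... | ψ , ψ∈ , refl with All.lookup facets ψ∈
      ...   | Gψ , max = ⊂-irrefl (subst (ρ ∪ ψ ⊂_) π≡ φ⊂π)
        where
        ρ⊆π : ρ ⊆ π
        ρ⊆π = proj₁ φ⊂π ∘ p⊆p∪q ψ

        π≡ : π ≡ ρ ∪ ψ
        π≡ = trans (sym (p⊆q⇒p∪q─p≡q ρ⊆π)) (cong (ρ ∪_) (max (π ─ ρ) (lk-face⁺ Kπ ρ⊆π)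
          (λ x∈ → x∈p∧x∉q⇒x∈p─q (proj₁ φ⊂π (q⊆p∪q ρ ψ x∈)) (proj₂ (lk-face⁻ Gψ) x∈))))

      cover : Upper (Face K) ρ ⊆ᵖ (_∈ˡ map (ρ ∪_) φs) ∪ᵖ Above ρ (G ∖ φs)
      cover {v} (ρ⊂v , Kv) with DecMembership._∈?_ _≟ˢ_ (v ─ ρ) φs
      ... | yes v∈ = inj₁ (subst (_∈ˡ map (ρ ∪_) φs) (p⊆q⇒p∪q─p≡q (proj₁ ρ⊂v)) (∈-map⁺ (ρ ∪_) v∈))
      ... | no  v∉ = inj₂ (ρ⊂v , lk-face⁺ Kv (proj₁ ρ⊂v) , v∉)

  -- If the target vertex is itself a removed facet, then all faces above ρ are vertices and any
  -- one of them may be kept.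
  retarget-RC : ∀ {D ρ a R} → (∀ {σ} → Face K σ → ∣ σ ∣ ≤ D) →
    (∀ {σ} → Face K σ → ∃ λ φ → Face K φ × σ ⊆ φ × ∣ φ ∣ ≡ D) →
    RemovalCollapse (Face K) ρ a R →
    ∀ {c} → c ∉ ρ → Face K (ρ ∪ ⁅ c ⁆) → ∃ λ R → RemovalCollapse (Face K) ρ (ρ ∪ ⁅ c ⁆) R
  retarget-RC {D} {ρ} {a} {R} bounded full rcR {c} c∉ρ Kρc = choose (cover (ρ⊂ρc , Kρc))
    where
    open RemovalCollapse rcR

    ρ⊂ρc : ρ ⊂ ρ ∪ ⁅ c ⁆
    ρ⊂ρc = p⊂p∪⁅x⁆ c∉ρ

    choose : ρ ∪ ⁅ c ⁆ ∈ˡ removed ⊎ R (ρ ∪ ⁅ c ⁆) → ∃ λ R → RemovalCollapse (Face K) ρ (ρ ∪ ⁅ c ⁆) R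
    choose (inj₂ Rρc) = R , record
      { removed = removed ; removed⊆ = removed⊆ ; maximal = maximal ; R⊆ = R⊆ ; cover = cover
      ; collapses = retarget (closed K) R⊆ R-lower collapses c∉ρ Rρc }
    choose (inj₁ ρc∈) = (_≡ ρ ∪ ⁅ c ⁆) , record
      -- The former end `a` is now deleted. The new end stays in the list as well as in the kept
      -- set, which is harmless because only its last occurrence counts.
      { removed   = a ∷ removed
      ; removed⊆  = removed′⊆
      ; maximal   = λ φ∈ Kπ φ⊂π → antichain (removed′⊆ φ∈) Kπ φ⊂π
      ; R⊆        = λ { refl → ρ⊂ρc , Kρc }
      ; cover     = λ u → inj₁ ([ there , (λ r → here (only collapses r)) ]′ (cover u))
      ; collapses = point ≐-refl
      }
      where
      D≡ : D ≡ suc ∣ ρ ∣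
      D≡ with full Kρc
      ... | φ , Kφ , ρc⊆φ , ∣φ∣≡D with p⊆q⇒p≡q⊎p⊂q ρc⊆φ
      ...   | inj₁ refl  = trans (sym ∣φ∣≡D) (x∉p⇒∣p∪⁅x⁆∣≡1+∣p∣ c∉ρ)
      ...   | inj₂ ρc⊂φ = contradiction ρc⊂φ (maximal ρc∈ Kφ)

      antichain : ∀ {σ π} → Upper (Face K) ρ σ → Face K π → ¬ σ ⊂ π
      antichain (ρ⊂σ , _) Kπ σ⊂π = ℕ.<-irrefl refl (ℕ.<-≤-trans (p⊂q⇒∣p∣<∣q∣ σ⊂π)
        (ℕ.≤-trans (subst (_ ≤_) D≡ (bounded Kπ)) (p⊂q⇒∣p∣<∣q∣ ρ⊂σ)))

      removed′⊆ : ∀ {φ} → φ ∈ˡ (a ∷ removed) → Upper (Face K) ρ φ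
      removed′⊆ (here refl) = R⊆ (CollapsesTo-∋ collapses)
      removed′⊆ (there φ∈)  = removed⊆ φ∈

      only : CollapsesTo a R → R ⊆ᵖ (_≡ a)
      only (point (e , _)) = e
      only (step _ _ Rσ Rτ σ⊂τ _ _ _) = contradiction σ⊂τ (antichain (R⊆ Rσ) (proj₂ (R⊆ Rτ)))

  HRC⇒HereditarilyRC : HRC K → ∀ {D} → (∀ {φ} → Facet K φ → ∣ φ ∣ ≡ D) → HereditarilyRC (Face K) D
  HRC⇒HereditarilyRC hrc {D} sizes = record
    { down = closed K ; bounded = bounded ; full = full ; rc = rc′ }
    where
    full : ∀ {σ} → Face K σ → ∃ λ φ → Face K φ × σ ⊆ φ × ∣ φ ∣ ≡ D
    full Kσ with facetAbove K Kσ
    ... | φ , facet , σ⊆φ = φ , proj₁ facet , σ⊆φ , sizes facet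

    bounded : ∀ {σ} → Face K σ → ∣ σ ∣ ≤ D
    bounded Kσ with full Kσ
    ... | φ , _ , σ⊆φ , refl = p⊆q⇒∣p∣≤∣q∣ σ⊆φ

    rc′ : ∀ {ρ c} → c ∉ ρ → Face K (ρ ∪ ⁅ c ⁆) → ∃ λ R → RemovalCollapse (Face K) ρ (ρ ∪ ⁅ c ⁆) R
    rc′ {ρ} {c} c∉ρ Kρc with hrc ρ (closed K (p⊆p∪q ⁅ c ⁆) Kρc)
    ... | inj₁ ¬vertex = ⊥-elim (¬vertex c (link-vertex c∉ρ Kρc))
    ... | inj₂ (φs , facets , coll) =
          retarget-RC bounded full (proj₂ (link-RC c∉ρ Kρc φs facets coll)) c∉ρ Kρc

  open CliqueComplex (_∼_ {n}) Sum.swap [ ⊂-irrefl , ⊂-irrefl ]′ _≟ˢ_ encode decode decode-encode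
    (encode-decode {n})

  -- A subdivision is a flag complex, since pairwise comparable faces form a chain. Lying strictly
  -- above `⊥` is the same as being nonempty.
  sd-cliques : CliquesOf (Upper (Face K) ⊥) (sd K)
  sd-cliques S = mk⇔
    (λ f → let faces , cmp = to (sdFace⇔sdChain K S) f in clique
      (λ {i} i∈ → above (faces i i∈))
      (λ {i} {j} i∈ j∈ → [ comparable , Sum.map sym Sum.swap ∘ comparable ]′
        (cmp i i∈ j j∈)))
    (λ (clique mem adj) → from (sdFace⇔sdChain K S)
      ((λ i i∈ → let (_ , x , x∈ , _) , Ki = mem i∈ in (x , x∈) , Ki) ,
       (λ i i∈ j j∈ → [ (λ { refl → inj₁ id }) ,
                        [ (λ p → inj₁ (proj₁ p)) , (λ p → inj₂ (proj₁ p)) ]′ ]′ (adj i∈ j∈))))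
    where
    above : ∀ {σ} → Nonempty σ × Face K σ → Upper (Face K) ⊥ σ
    above {σ} ((x , x∈σ) , Kσ) = (⊆-min σ , x , x∈σ , ∉⊥) , Kσ

    comparable : ∀ {i j} → decode {n} i ⊆ decode j → i ≡ j ⊎ decode {n} i ∼ decode j
    comparable i⊆j = Sum.map elem-injective inj₁ (p⊆q⇒p≡q⊎p⊂q i⊆j)

theorem2 : (n : ℕ) (K : Complex n) (d : ℤ) →
    Pure K → HasDimension K d → HRC K →
    StarDecomposableInVertices (sd (sd K))
theorem2 n K d pureK ((σ , Kσ , _) , _) hrc with facetAbove K Kσ
-- Purity makes `∣ φ ∣` the size of every facet, hence the rank of the link of `⊥`, which is `K`
-- itself; the target is its full vertex set.
... | φ , facet , _ = subdivision (sd K) (starDecomposable ∣ φ ∣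
        (decomp-all (decomposes ∣ φ ∣) (HRC⇒HereditarilyRC K hrc same-size)
          (closed K (⊆-min σ) Kσ) (trans (cong (λ i → ∣ φ ∣ + i) (∣⊥∣≡0 n)) (ℕ.+-identityʳ _)))
        (sd-cliques K)
        (λ i → mk⇔ (vertex⁻ {X = sd K} (sd-cliques K)) (vertex⁺ {X = sd K} (sd-cliques K))))
  where
  open FacePoset {n}
  open CliqueComplex (_∼_ {n}) Sum.swap [ ⊂-irrefl , ⊂-irrefl ]′ _≟ˢ_ encode decode decode-encode
    (encode-decode {n})

  same-size : ∀ {ψ} → Facet K ψ → ∣ ψ ∣ ≡ ∣ φ ∣
  same-size {ψ} facetψ = ℤ.+-injective (∙-cancelʳ -1ℤ _ _ (pureK ψ φ facetψ facet))
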